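{- Let $p$ be a prime, $f\ge 1$ an integer, $q=p^f$, and let $k\ge 1$, $d\ge 1$, $e\ge 0$ be integers. Let $C$ be a $[g_q(k,d),k,d]_q$ Griesmer code. If $p^e\mid d$, then $\left\lceil p^{\,e-(f-1)(q-2)}\right\rceil$ divides $\mathrm{wt}(c)$ for every codeword $c\in C$.
   Context: An $[n,k,d]_q$ code is a $k$-dimensional $\mathbb{F}_q$-linear subspace of $\mathbb{F}_q^n$ whose minimum Hamming weight of a nonzero codeword is $d$; $\mathrm{wt}(c)$ is the number of nonzero coordinates of $c$. For positive integers $k,d$, $g_q(k,d):=\sum_{i=0}^{k-1}\lceil d/q^i\rceil$. An $[n,k,d]_q$ code with $n=g_q(k,d)$ is called a Griesmer code. Codes are assumed to have full length (no coordinate at which all codewords vanish). -}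

module Defs where

open import Level using (0ℓ)
open import Data.Nat using (ℕ; zero; suc)
import Data.Nat as N
open import Data.Nat.DivMod using (_/_)
open import Data.Fin using (Fin)
import Data.Fin as Fin
open import Data.Product using (∃; _×_)
open import Relation.Nullary using (¬_; yes; no)
open import Relation.Binary.Core using (Rel)
open import Relation.Binary.Definitions using (Decidable)
open import Relation.Binary.PropositionalEquality using (_≡_)
open import Algebra.Bundles using (CommutativeRing)
import Data.Vec.Functional as V

-- Ceiling division ⌈ d / m ⌉ for m ≥ 1 (the value at m = 0 is irrelevant
-- and never used: it is only applied to powers of q ≥ 2).
ceilDiv : ℕ → ℕ → ℕ
ceilDiv d zero    = 0
ceilDiv d (suc m) = (d N.+ m) / suc m

griesmer : ℕ → ℕ → ℕ → ℕ
griesmer q zero    d = 0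
griesmer q (suc k) d = griesmer q k d N.+ ceilDiv d (q N.^ k)

record FiniteField (q : ℕ) : Set₁ where
  field
    commRing : CommutativeRing 0ℓ 0ℓ
  open CommutativeRing commRing public hiding (ring)
  field
    _≟_      : Decidable _≈_
    0≉1      : ¬ (0# ≈ 1#)
    inverse  : ∀ x → ¬ (x ≈ 0#) → ∃ λ y → (x * y) ≈ 1#
    enum     : Fin q → Carrier
    enum-sur : ∀ x → ∃ λ i → enum i ≈ x
    enum-inj : ∀ i j → enum i ≈ enum j → i ≡ j

module _ {q : ℕ} (F : FiniteField q) where
  open FiniteField F

  Word : ℕ → Set
  Word n = Fin n → Carrier

  wt : ∀ {n} → Word n → ℕ
  wt {zero}  c = 0
  wt {suc n} c with c Fin.zero ≟ 0#
  ... | yes _ = wt (V.tail c)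
  ... | no  _ = suc (wt (V.tail c))

  isZero : ∀ {n} → Word n → Set
  isZero c = ∀ j → c j ≈ 0#

  Matrix : ℕ → ℕ → Set
  Matrix k n = Fin k → Fin n → Carrier

  encode : ∀ {k n} → Matrix k n → Word k → Word n
  encode G m j = V.foldr _+_ 0# (λ i → m i * G i j)

  -- G generates an [n,k,d] linear code of full length:
  --  * rows linearly independent (so the code mG has dimension k),
  --  * no coordinate at which all codewords vanish,
  --  * minimum nonzero weight exactly d.
  record IsLinearCode {k n : ℕ} (G : Matrix k n) (d : ℕ) : Set where
    field
      rowsIndependent : ∀ m → isZero (encode G m) → isZero m
      fullLength      : ∀ j → ∃ λ i → ¬ (G i j ≈ 0#)
      minWeight≥      : ∀ m → ¬ isZero m → d N.≤ wt (encode G m)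
      minWeightAttained : ∃ λ m → ¬ isZero m × wt (encode G m) ≡ d

{-# OPTIONS --safe #-}

-- It suffices that q^(i+1) ∣ d forces q^i p to divide every weight; this is proved by induction on
-- the dimension k + 1.  View the columns as functionals.  By the Griesmer bound a point ψ carries
-- at most ⌈d/q^k⌉ columns, and if it carries that many, the subcode of the messages in ker ψ is
-- again a Griesmer code with the same d, so its weights are divisible by q^i p.  Let x be a message
-- and S the set of these maximal points, normalised by ψ(x) = 1.  Counting the columns not
-- vanishing at x gives |S| ≥ q^(i+1), unless q^k ∣ d, when all nonzero weights equal d.
--
-- Divisibility then spreads from the hyperplanes ker ψ, ψ ∈ S, to x, by induction on i.  If |S| ≥ q²,
-- a second moment argument yields a message b such that ψ ↦ ψ(b) maps S onto the field.
-- Translating b by a multiple of x, at least |S|/q of the ψ ∈ S vanish at b; summing weights over the lines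
-- y + 𝔽b expresses q times the weight on the columns killed by b, which replaces i by i - 1.
-- For i = 0, the weight mod p is a polynomial function of degree at most q - 1 that vanishes on q
-- distinct hyperplanes, hence is zero.
module Submission where

open import Defs
open import Data.Nat using (ℕ; _≤_; _^_; _*_; _∸_)
open import Data.Nat.Divisibility using (_∣_)
open import Data.Nat.Primality using (Prime)

open import Algebra.Bundles using (CommutativeRing; RawRing)
open import Algebra.Core using (Op₁; Op₂)
open import Algebra.Morphism.Structures using (IsRingMonomorphism)
open import Algebra.Structures using (IsCommutativeRing)
open import Data.Bool.Base using (Bool; true; false; _∧_; not; if_then_else_)
open import Data.Fin.Base using (Fin; zero; suc; punchIn; punchOut)
open import Data.Fin.Permutation using (Permutation′; permutation)
open import Data.Fin.Properties using (¬∀⟶∃¬; punchIn-punchOut; punchInᵢ≢i)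
  renaming (_≟_ to _≟F_; any? to anyF?; all? to allF?)
open import Data.List.Base using (List; []; _∷_; length; filter; map)
open import Data.List.Properties using (length-map; length-tabulate; filter-accept; filter-reject)
open import Data.Nat.Base using (zero; suc; _+_; _<_; z≤n; s≤s; NonZero; >-nonZero; nonTrivial⇒n>1)
open import Data.Nat.Coprimality using (Coprime; coprime-Bézout)
open import Data.Nat.Divisibility
  using (divides; quotient; _∣?_; _∣0; 1∣_; ∣-trans; ∣⇒≤; ∣m∣n⇒∣m+n; ∣m+n∣m⇒∣n; ∣n⇒∣m*n;
         *-monoʳ-∣; *-cancelˡ-∣)
open import Data.Nat.DivMod using (_/_; _%_; m≡m%n+[m/n]*n; m%n<n; m<n*o⇒m/o<n; m≥n⇒m/n>0)
open import Data.Nat.GCD using (module Bézout)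
open import Data.Nat.Primality using (prime⇒irreducible; prime⇒nonTrivial)
open import Data.Nat.Properties hiding (_≟_)
open import Data.Nat.Solver using (module +-*-Solver)
open import Data.Product.Base using (∃; _×_; _,_; proj₁; proj₂)
open import Data.Sum.Base using (_⊎_; inj₁; inj₂)
open import Data.Vec.Base using (Vec; []; _∷_; head; tail; replicate; zipWith; tabulate; lookup)
open import Data.Vec.Functional using (removeAt)
open import Function.Base using (_∘_)
open import Level using (0ℓ)
open import Relation.Binary.PropositionalEquality
open import Relation.Nullary using (¬_; Dec; yes; no; does; ¬?; contradiction)
open import Relation.Nullary.Decidable using (_×-dec_)
import Algebra.Morphism.RingMonomorphism as RingMonomorphism
import Algebra.Properties.CommutativeMonoid.Sum as CommutativeMonoidSum
import Algebra.Properties.Group as GroupProperties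
import Algebra.Properties.Ring as RingProperties
import Algebra.Properties.Semiring.Mult as SemiringMult
import Algebra.Solver.Ring.NaturalCoefficients.Default as RingSolver
import Data.Bool.Properties as Bool
import Data.List.Base as List
import Data.Vec.Base as Vec
import Data.Vec.Functional as Vector
import Data.Vec.Properties as Vecₚ

-- Finite sums of natural numbers and indicator functions.

private module ℕ∑ = CommutativeMonoidSum +-0-commutativeMonoid

-- Opaque, so that the summands in equational steps are found by unification.
opaque

  sum : ∀ {n} → (Fin n → ℕ) → ℕ
  sum = ℕ∑.sum

  sum-cong : ∀ {n} {f g : Fin n → ℕ} → (∀ i → f i ≡ g i) → sum f ≡ sum g
  sum-cong = ℕ∑.sum-cong-≗

  sum-remove : ∀ {n} (f : Fin (suc n) → ℕ) i → sum f ≡ f i + sum (removeAt f i)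
  sum-remove f i = ℕ∑.sum-remove {i = i} f

  sum-comm : ∀ {m n} (f : Fin m → Fin n → ℕ) →
             sum (λ i → sum (f i)) ≡ sum (λ j → sum λ i → f i j)
  sum-comm = ℕ∑.∑-comm

  sum-+ : ∀ {n} (f g : Fin n → ℕ) → sum (λ i → f i + g i) ≡ sum f + sum g
  sum-+ = ℕ∑.∑-distrib-+

  sum-*ˡ : ∀ {n} c (f : Fin n → ℕ) → sum (λ i → c * f i) ≡ c * sum f
  sum-*ˡ {zero}  c f = sym (*-zeroʳ c)
  sum-*ˡ {suc n} c f = trans (cong (c * f zero +_) (sum-*ˡ c (f ∘ suc))) (sym (*-distribˡ-+ c (f zero) _))

toℕᵇ : Bool → ℕ
toℕᵇ b = if b then 1 else 0

χ : ∀ {a} {P : Set a} → Dec P → ℕ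
χ d = toℕᵇ (does d)

module _ {a} {P : Set a} where

  χ-yes : (d : Dec P) → P → χ d ≡ 1
  χ-yes (yes _) _ = refl
  χ-yes (no ¬p) p = contradiction p ¬p

  χ-no : (d : Dec P) → ¬ P → χ d ≡ 0
  χ-no (yes p) ¬p = contradiction p ¬p
  χ-no (no _)  _  = refl

χ-cong : ∀ {a b} {P : Set a} {Q : Set b} (d : Dec P) (e : Dec Q) →
         (P → Q) → (Q → P) → χ d ≡ χ e
χ-cong (yes p) e f g = sym (χ-yes e (f p))
χ-cong (no ¬p) e f g = sym (χ-no e (¬p ∘ g))

opaque
  unfolding sum

  sum-mono : ∀ {n} {f g : Fin n → ℕ} → (∀ i → f i ≤ g i) → sum f ≤ sum g
  sum-mono {zero}  f≤g = z≤n
  sum-mono {suc n} f≤g = +-mono-≤ (f≤g zero) (sum-mono (f≤g ∘ suc))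

  sum-const : ∀ n c → sum {n} (λ _ → c) ≡ n * c
  sum-const zero    c = refl
  sum-const (suc n) c = cong (c +_) (sum-const n c)

  term≤sum : ∀ {n} (f : Fin n → ℕ) i → f i ≤ sum f
  term≤sum f zero    = m≤m+n _ _
  term≤sum f (suc i) = ≤-trans (term≤sum (f ∘ suc) i) (m≤n+m _ (f zero))

  sum-δ : ∀ {n} (j : Fin n) → sum (λ i → χ (i ≟F j)) ≡ 1
  sum-δ {suc n} zero = cong suc (trans (sum-const n 0) (*-zeroʳ n))
  sum-δ {suc n} (suc j) =
    trans (sum-cong λ i → χ-cong (suc i ≟F suc j) (i ≟F j) (λ { refl → refl }) (cong suc)) (sum-δ j)

  sum-δ* : ∀ {n} (j : Fin n) (f : Fin n → ℕ) → sum (λ i → χ (j ≟F i) * f i) ≡ f j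
  sum-δ* {suc n} zero f = trans (cong₂ _+_ (+-identityʳ (f zero)) (trans (sum-const n 0) (*-zeroʳ n))) (+-identityʳ (f zero))
  sum-δ* {suc n} (suc j) f =
    trans (sum-cong λ i → cong (_* f (suc i)) (χ-cong (suc j ≟F suc i) (j ≟F i) (λ { refl → refl }) (cong suc)))
      (sum-δ* j (f ∘ suc))

  sum-∣ : ∀ {n d} {f : Fin n → ℕ} → (∀ i → d ∣ f i) → d ∣ sum f
  sum-∣ {zero}  d∣f = _ ∣0
  sum-∣ {suc n} d∣f = ∣m∣n⇒∣m+n (d∣f zero) (sum-∣ (d∣f ∘ suc))

  sum-< : ∀ {n c} (f : Fin (suc n) → ℕ) → (∀ i → f i < c) → sum f < suc n * c
  sum-< {zero}  f f<c = +-mono-<-≤ (f<c zero) z≤n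
  sum-< {suc n} f f<c = +-mono-< (f<c zero) (sum-< (f ∘ suc) (f<c ∘ suc))

-- Pigeonhole: terms all below `c` would sum to less than `suc n * c`.
large-term : ∀ {n} (f : Fin (suc n) → ℕ) {c} → suc n * c ≤ sum f → ∃ λ i → c ≤ f i
large-term f {c} le with anyF? (λ i → c ≤? f i)
... | yes p = p
... | no ¬p = contradiction le (<⇒≱ (sum-< f λ i → ≰⇒> λ c≤ → ¬p (i , c≤)))

-- The Cauchy-Schwarz inequality over the natural numbers.

-- Raising both arguments by one adds 2 + 2m + 2n to either side, so the induction avoids
-- subtraction.
2mn≤m²+n² : ∀ m n → 2 * (m * n) ≤ m * m + n * n
2mn≤m²+n² zero n = z≤n
2mn≤m²+n² (suc m) zero = ≤-trans (≤-reflexive (trans (cong (2 *_) (*-zeroʳ (suc m))) (*-zeroʳ 2))) z≤n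
2mn≤m²+n² (suc m) (suc n) = begin
  2 * (suc m * suc n)                       ≡⟨ lhs m n ⟩
  2 * (m * n) + (2 + 2 * m + 2 * n)         ≤⟨ +-monoˡ-≤ _ (2mn≤m²+n² m n) ⟩
  (m * m + n * n) + (2 + 2 * m + 2 * n)     ≡⟨ rhs m n ⟩
  suc m * suc m + suc n * suc n             ∎
  where
  open ≤-Reasoning
  open +-*-Solver
  lhs : ∀ m n → 2 * (suc m * suc n) ≡ 2 * (m * n) + (2 + 2 * m + 2 * n)
  lhs = solve 2 (λ m n → con 2 :* ((con 1 :+ m) :* (con 1 :+ n)) :=
                  con 2 :* (m :* n) :+ (con 2 :+ con 2 :* m :+ con 2 :* n)) refl
  rhs : ∀ m n → (m * m + n * n) + (2 + 2 * m + 2 * n) ≡ suc m * suc m + suc n * suc n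
  rhs = solve 2 (λ m n → (m :* m :+ n :* n) :+ (con 2 :+ con 2 :* m :+ con 2 :* n) :=
                  (con 1 :+ m) :* (con 1 :+ m) :+ (con 1 :+ n) :* (con 1 :+ n)) refl

-- The square of the sum is a double sum of products; each product is bounded by half the sum of the
-- two squares.
cauchy-schwarz : ∀ {n} (f : Fin n → ℕ) → sum f * sum f ≤ n * sum (λ i → f i * f i)
cauchy-schwarz {n} f = *-cancelˡ-≤ 2 (begin
  2 * (sum f * sum f)                              ≡⟨ cong (2 *_) sum² ⟩
  2 * sum (λ i → sum λ j → f i * f j)              ≡⟨ sum-*ˡ 2 _ ⟨
  sum (λ i → 2 * sum λ j → f i * f j)              ≡⟨ sum-cong (λ i → sum-*ˡ 2 _) ⟨
  sum (λ i → sum λ j → 2 * (f i * f j))            ≤⟨ sum-mono (λ i → sum-mono λ j → 2mn≤m²+n² (f i) (f j)) ⟩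
  sum (λ i → sum λ j → f i * f i + f j * f j)
    ≡⟨ sum-cong (λ i → sum-+ (λ _ → f i * f i) (λ j → f j * f j)) ⟩
  sum (λ i → sum {n} (λ _ → f i * f i) + Q)        ≡⟨ sum-+ (λ i → sum {n} (λ _ → f i * f i)) (λ _ → Q) ⟩
  sum (λ i → sum {n} (λ _ → f i * f i)) + sum {n} (λ _ → Q)
    ≡⟨ cong (_+ sum {n} (λ _ → Q)) (sum-comm (λ i _ → f i * f i)) ⟩
  sum {n} (λ _ → Q) + sum {n} (λ _ → Q)            ≡⟨ cong₂ _+_ (sum-const n Q) (sum-const n Q) ⟩
  n * Q + n * Q                                    ≡⟨ cong (n * Q +_) (+-identityʳ (n * Q)) ⟨
  2 * (n * Q)                                      ∎)
  where
  open ≤-Reasoning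
  Q = sum λ i → f i * f i
  sum² : sum f * sum f ≡ sum (λ i → sum λ j → f i * f j)
  sum² = trans (sym (sum-*ˡ (sum f) f))
    (sum-cong λ i → trans (*-comm (sum f) (f i)) (sym (sum-*ˡ (f i) f)))

cauchy-schwarz-missing : ∀ {n} (f : Fin (suc n) → ℕ) j → f j ≡ 0 →
                         sum f * sum f ≤ n * sum (λ i → f i * f i)
cauchy-schwarz-missing {n} f j fj≡0 = begin
  sum f * sum f                            ≡⟨ cong₂ _*_ drop drop ⟩
  sum (removeAt f j) * sum (removeAt f j)  ≤⟨ cauchy-schwarz (removeAt f j) ⟩
  n * sum (removeAt (λ i → f i * f i) j)   ≤⟨ *-monoʳ-≤ n (m≤n+m _ (f j * f j)) ⟩
  n * (f j * f j + sum (removeAt (λ i → f i * f i) j)) ≡⟨ cong (n *_) (sum-remove (λ i → f i * f i) j) ⟨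
  n * sum (λ i → f i * f i)                ∎
  where
  open ≤-Reasoning
  drop : sum f ≡ sum (removeAt f j)
  drop = trans (sum-remove f j) (cong (_+ sum (removeAt f j)) fj≡0)

-- Exhaustive search and summation over coordinate vectors.

infix 4 _≟V_

_≟V_ : ∀ {q k} (u v : Vec (Fin q) k) → Dec (u ≡ v)
_≟V_ = Vecₚ.≡-dec _≟F_

∃V? : ∀ {q k} {P : Vec (Fin q) k → Set} → (∀ v → Dec (P v)) → Dec (∃ P)
∃V? {k = zero} P? with P? []
... | yes p = yes ([] , p)
... | no ¬p = no λ { ([] , p) → ¬p p }
∃V? {k = suc k} P? with anyF? (λ a → ∃V? (λ v → P? (a ∷ v)))
... | yes (a , v , p) = yes (a ∷ v , p)
... | no ¬p = no λ { (a ∷ v , p) → ¬p (a , v , p) }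

opaque

  sumV : ∀ {q k} → (Vec (Fin q) k → ℕ) → ℕ
  sumV {k = zero}  f = f []
  sumV {k = suc k} f = sum λ a → sumV λ v → f (a ∷ v)

module _ {q : ℕ} where

  private
    V : ℕ → Set
    V = Vec (Fin q)

  opaque
    unfolding sumV

    sumV-∷ : ∀ {k} (f : V (suc k) → ℕ) → sumV f ≡ sum (λ a → sumV λ v → f (a ∷ v))
    sumV-∷ f = refl

    sumV-cong : ∀ {k} {f g : V k → ℕ} → (∀ v → f v ≡ g v) → sumV f ≡ sumV g
    sumV-cong {zero}  f≗g = f≗g []
    sumV-cong {suc k} f≗g = sum-cong λ a → sumV-cong λ v → f≗g (a ∷ v)

    sumV-mono : ∀ {k} {f g : V k → ℕ} → (∀ v → f v ≤ g v) → sumV f ≤ sumV g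
    sumV-mono {zero}  f≤g = f≤g []
    sumV-mono {suc k} f≤g = sum-mono λ a → sumV-mono λ v → f≤g (a ∷ v)

    sumV-+ : ∀ {k} (f g : V k → ℕ) → sumV (λ v → f v + g v) ≡ sumV f + sumV g
    sumV-+ {zero}  f g = refl
    sumV-+ {suc k} f g = trans
      (sum-cong λ a → sumV-+ (λ v → f (a ∷ v)) (λ v → g (a ∷ v)))
      (sum-+ (λ a → sumV λ v → f (a ∷ v)) (λ a → sumV λ v → g (a ∷ v)))

    sumV-*ˡ : ∀ {k} c (f : V k → ℕ) → sumV (λ v → c * f v) ≡ c * sumV f
    sumV-*ˡ {zero}  c f = refl
    sumV-*ˡ {suc k} c f = trans (sum-cong λ a → sumV-*ˡ c (λ v → f (a ∷ v))) (sum-*ˡ c _)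

    sumV-const : ∀ k c → sumV {q} {k} (λ _ → c) ≡ q ^ k * c
    sumV-const zero    c = sym (+-identityʳ c)
    sumV-const (suc k) c = trans (sum-cong λ _ → sumV-const k c)
      (trans (sum-const q _) (sym (*-assoc q (q ^ k) c)))

    term≤sumV : ∀ {k} (f : V k → ℕ) v → f v ≤ sumV f
    term≤sumV f []      = ≤-refl
    term≤sumV f (a ∷ v) = ≤-trans (term≤sumV (λ v → f (a ∷ v)) v) (term≤sum (λ a → sumV λ v → f (a ∷ v)) a)

    sumV-sum : ∀ {k n} (f : Fin n → V k → ℕ) →
               sumV (λ v → sum λ i → f i v) ≡ sum (λ i → sumV (f i))
    sumV-sum {zero}  f = refl
    sumV-sum {suc k} f = trans (sum-cong λ a → sumV-sum (λ i v → f i (a ∷ v)))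
      (sum-comm (λ a i → sumV λ v → f i (a ∷ v)))

    sumV-comm : ∀ {k l} (f : V k → V l → ℕ) →
                sumV (λ u → sumV (f u)) ≡ sumV (λ v → sumV λ u → f u v)
    sumV-comm {zero}  f = refl
    sumV-comm {suc k} f = trans (sum-cong λ a → sumV-comm (λ u → f (a ∷ u)))
      (sym (sumV-sum (λ a v → sumV λ u → f (a ∷ u) v)))

    sumV-δ : ∀ {k} (u : V k) (f : V k → ℕ) → sumV (λ v → χ (v ≟V u) * f v) ≡ f u
    sumV-δ []      f = +-identityʳ _
    sumV-δ {suc k} (b ∷ u) f = begin
      sum (λ a → sumV λ v → χ ((a ∷ v) ≟V (b ∷ u)) * f (a ∷ v))
        ≡⟨ sum-cong (λ a → sumV-cong λ v → split a v) ⟩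
      sum (λ a → sumV λ v → χ (a ≟F b) * (χ (v ≟V u) * f (b ∷ v)))
        ≡⟨ sum-cong (λ a → sumV-*ˡ {k} (χ (a ≟F b)) _) ⟩
      sum (λ a → χ (a ≟F b) * T)  ≡⟨ sum-cong (λ a → *-comm (χ (a ≟F b)) T) ⟩
      sum (λ a → T * χ (a ≟F b))  ≡⟨ sum-*ˡ T _ ⟩
      T * sum (λ a → χ (a ≟F b))  ≡⟨ cong (T *_) (sum-δ b) ⟩
      T * 1                       ≡⟨ *-identityʳ T ⟩
      T                           ≡⟨ sumV-δ u (λ v → f (b ∷ v)) ⟩
      f (b ∷ u)                   ∎
      where
      open ≡-Reasoning
      T : ℕ
      T = sumV λ v → χ (v ≟V u) * f (b ∷ v)
      split : ∀ a v → χ ((a ∷ v) ≟V (b ∷ u)) * f (a ∷ v) ≡ χ (a ≟F b) * (χ (v ≟V u) * f (b ∷ v))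
      split a v with a ≟F b
      ... | no _     = refl
      ... | yes refl = sym (+-identityʳ _)

  sumV-positive : ∀ {k} (f : V k → ℕ) → 1 ≤ sumV f → ∃ λ v → 1 ≤ f v
  sumV-positive {k} f pos with ∃V? (λ v → 1 ≤? f v)
  ... | yes p = p
  ... | no ¬p = contradiction pos (<⇒≱ (s≤s (≤-trans
    (sumV-mono {g = λ _ → 0} λ v → ≤-pred (≰⇒> λ 1≤ → ¬p (v , 1≤)))
    (≤-reflexive (trans (sumV-const k 0) (*-zeroʳ (q ^ k)))))))

-- Ceiling division and the Griesmer sum.

-- Together with `ceilDiv-least` this characterises `ceilDiv d m` as the least t with d ≤ m t; the
-- other facts about ceilings follow from the pair.
ceilDiv-upper : ∀ d m .{{_ : NonZero m}} → d ≤ m * ceilDiv d m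
ceilDiv-upper d (suc m) = +-cancelʳ-≤ m d _ (begin
  d + m                                                    ≡⟨ m≡m%n+[m/n]*n (d + m) (suc m) ⟩
  (d + m) % suc m + ceilDiv d (suc m) * suc m              ≤⟨ +-monoˡ-≤ _ (≤-pred (m%n<n (d + m) (suc m))) ⟩
  m + ceilDiv d (suc m) * suc m                            ≡⟨ +-comm m _ ⟩
  ceilDiv d (suc m) * suc m + m
    ≡⟨ cong (_+ m) (*-comm (ceilDiv d (suc m)) (suc m)) ⟩
  suc m * ceilDiv d (suc m) + m                            ∎)
  where open ≤-Reasoning

ceilDiv-least : ∀ {d m t} .{{_ : NonZero m}} → d ≤ m * t → ceilDiv d m ≤ t
ceilDiv-least {d} {suc m} {t} d≤mt = ≤-pred (m<n*o⇒m/o<n (begin-strict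
  d + m                 <⟨ +-mono-≤-< d≤mt (n<1+n m) ⟩
  suc m * t + suc m     ≡⟨ +-comm (suc m * t) (suc m) ⟩
  suc m + suc m * t     ≡⟨ *-suc (suc m) t ⟨
  suc m * suc t         ≡⟨ *-comm (suc m) (suc t) ⟩
  suc t * suc m         ∎))
  where open ≤-Reasoning

ceilDiv-mono : ∀ {d e} m .{{_ : NonZero m}} → d ≤ e → ceilDiv d m ≤ ceilDiv e m
ceilDiv-mono {e = e} m d≤e = ceilDiv-least (≤-trans d≤e (ceilDiv-upper e m))

ceilDiv-lower : ∀ {d} m .{{_ : NonZero m}} → 1 ≤ d → ∃ λ a → ceilDiv d m ≡ suc a × a * m < d
ceilDiv-lower {d} m 1≤d with ceilDiv d m in eq
... | zero = contradiction (≤-trans 1≤d (subst (d ≤_) (trans (cong (m *_) eq) (*-zeroʳ m)) (ceilDiv-upper d m))) λ ()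
... | suc a = a , refl , ≰⇒> λ d≤am → contradiction
  (ceilDiv-least (subst (d ≤_) (*-comm a m) d≤am)) (<⇒≱ (subst (a <_) (sym eq) ≤-refl))

-- Both sides are the least t with d ≤ m n t.
ceilDiv-ceilDiv : ∀ d m n .{{_ : NonZero m}} .{{_ : NonZero n}} →
                  ceilDiv (ceilDiv d m) n ≡ ceilDiv d (m * n)
ceilDiv-ceilDiv d m n = ≤-antisym
  (ceilDiv-least (ceilDiv-least (subst (d ≤_) (*-assoc m n _) (ceilDiv-upper d (m * n) {{m*n≢0 m n}}))))
  (ceilDiv-least {{m*n≢0 m n}} (≤-trans (ceilDiv-upper d m) (subst (m * ceilDiv d m ≤_) (sym (*-assoc m n _))
    (*-monoʳ-≤ m (ceilDiv-upper (ceilDiv d m) n)))))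

module _ (q : ℕ) .{{_ : NonZero q}} where

  -- `griesmer` splits off its last summand by definition. Passing to a residual code needs the
  -- first one split off, the rest being the Griesmer sum of ⌈d/q⌉ by nesting of ceilings.
  griesmer-suc : ∀ k d → griesmer q (suc k) d ≡ d + griesmer q k (ceilDiv d q)
  griesmer-suc zero d = trans (≤-antisym (ceilDiv-least {m = 1} (≤-reflexive (sym (*-identityˡ d))))
    (subst (d ≤_) (*-identityˡ _) (ceilDiv-upper d 1))) (sym (+-identityʳ d))
  griesmer-suc (suc k) d = trans (cong₂ _+_ (griesmer-suc k d) (sym (ceilDiv-ceilDiv d q (q ^ k)))) (+-assoc d _ _)
    where instance _ = m^n≢0 q k

  griesmer-mono : ∀ k {d e} → d ≤ e → griesmer q k d ≤ griesmer q k e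
  griesmer-mono zero    d≤e = z≤n
  griesmer-mono (suc k) d≤e = +-mono-≤ (griesmer-mono k d≤e) (ceilDiv-mono (q ^ k) {{m^n≢0 q k}} d≤e)

-- The difference is a positive multiple of `D`. This converts a strict inequality into the lower
-- bound for the number of maximal points.
next-multiple : ∀ {D m n} → D ∣ m → D ∣ n → m < n → m + D ≤ n
next-multiple {D} {m} {n} D∣m D∣n m<n = subst (m + D ≤_) (m+[n∸m]≡n (<⇒≤ m<n))
  (+-monoʳ-≤ m (∣⇒≤ {{>-nonZero (m<n⇒0<n∸m m<n)}} (∣m+n∣m⇒∣n (subst (D ∣_) (sym (m+[n∸m]≡n (<⇒≤ m<n))) D∣n) D∣m)))

^-monoʳ-∣ : ∀ b {m n} → m ≤ n → b ^ m ∣ b ^ n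
^-monoʳ-∣ b {m} {n} m≤n = divides (b ^ (n ∸ m)) (trans (cong (b ^_) (sym (m∸n+n≡m m≤n))) (^-distribˡ-+-* b (n ∸ m) m))

-- Finite fields carried by an initial segment of the natural numbers.

-- With `Fin q` as carrier and propositional equality, vectors can be searched exhaustively and
-- counting is summation over indices.
record DiscreteField (q : ℕ) : Set where
  infix  8 ⊖_
  infixl 7 _⊗_
  infixl 6 _⊕_
  field
    _⊕_ _⊗_           : Op₂ (Fin q)
    ⊖_                : Op₁ (Fin q)
    𝟎 𝟏               : Fin q
    isCommutativeRing : IsCommutativeRing _≡_ _⊕_ _⊗_ ⊖_ 𝟎 𝟏
    𝟎≢𝟏               : 𝟎 ≢ 𝟏
    inverse           : ∀ x → x ≢ 𝟎 → ∃ λ y → x ⊗ y ≡ 𝟏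

  commutativeRing : CommutativeRing 0ℓ 0ℓ
  commutativeRing = record { isCommutativeRing = isCommutativeRing }

  open CommutativeRing commutativeRing public
    using (ring; semiring; commutativeSemiring; +-group; +-commutativeMonoid)
    renaming
      ( +-assoc to ⊕-assoc; +-comm to ⊕-comm; +-identityˡ to ⊕-identityˡ; +-identityʳ to ⊕-identityʳ
      ; *-assoc to ⊗-assoc; *-comm to ⊗-comm; *-identityˡ to ⊗-identityˡ; *-identityʳ to ⊗-identityʳ
      ; -‿inverseˡ to ⊖-inverseˡ; -‿inverseʳ to ⊖-inverseʳ
      ; zeroˡ to ⊗-zeroˡ; zeroʳ to ⊗-zeroʳ; distribˡ to ⊗-distribˡ )
  open RingProperties ring public using (-1*x≈-x; -‿distribˡ-*; -‿distribʳ-*)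
  open GroupProperties +-group public using (x∙y⁻¹≈ε⇒x≈y; inverseʳ-unique; identityʳ-unique)

-- Linear functionals, weights and counting on lines and hyperplanes.

module LinearAlgebra (q′ : ℕ) (𝔽 : DiscreteField (suc q′)) where

  open DiscreteField 𝔽
  open RingSolver commutativeSemiring using (solve; _:=_; _:+_; _:*_)

  q : ℕ
  q = suc q′

  K : Set
  K = Fin q

  V : ℕ → Set
  V = Vec K

  ⊗-cancelˡ : ∀ a {b c} → a ≢ 𝟎 → a ⊗ b ≡ a ⊗ c → b ≡ c
  ⊗-cancelˡ a {b} {c} a≢0 ab≡ac with inverse a a≢0
  ... | a⁻¹ , aa⁻¹≡1 = trans (sym (undo b)) (trans (cong (a⁻¹ ⊗_) ab≡ac) (undo c))
    where
    undo : ∀ x → a⁻¹ ⊗ (a ⊗ x) ≡ x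
    undo x = trans (solve 3 (λ a i x → i :* (a :* x) := (a :* i) :* x) refl a a⁻¹ x)
      (trans (cong (_⊗ x) aa⁻¹≡1) (⊗-identityˡ x))

  ⊗-nonzero : ∀ {a b} → a ≢ 𝟎 → b ≢ 𝟎 → a ⊗ b ≢ 𝟎
  ⊗-nonzero {a} a≢0 b≢0 ab≡0 = b≢0 (⊗-cancelˡ a a≢0 (trans ab≡0 (sym (⊗-zeroʳ a))))

  ⊕-⊖-cancel : ∀ a b → (a ⊕ b) ⊕ ⊖ b ≡ a
  ⊕-⊖-cancel a b = trans (⊕-assoc a b (⊖ b)) (trans (cong (a ⊕_) (⊖-inverseʳ b)) (⊕-identityʳ a))

  ⊖-⊕-cancel : ∀ a b → (a ⊕ ⊖ b) ⊕ b ≡ a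
  ⊖-⊕-cancel a b = trans (⊕-assoc a (⊖ b) b) (trans (cong (a ⊕_) (⊖-inverseˡ b)) (⊕-identityʳ a))

  infixl 6 _⊞_
  infixr 7 _·_

  _⊞_ : ∀ {k} → V k → V k → V k
  _⊞_ = zipWith _⊕_

  _·_ : ∀ {k} → K → V k → V k
  a · v = Vec.map (a ⊗_) v

  𝟘 : ∀ {k} → V k
  𝟘 = replicate _ 𝟎

  ⟨_,_⟩ : ∀ {k} → V k → V k → K
  ⟨ [] , [] ⟩ = 𝟎
  ⟨ a ∷ u , b ∷ v ⟩ = a ⊗ b ⊕ ⟨ u , v ⟩

  ⟨⟩-comm : ∀ {k} (u v : V k) → ⟨ u , v ⟩ ≡ ⟨ v , u ⟩
  ⟨⟩-comm []      []      = refl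
  ⟨⟩-comm (a ∷ u) (b ∷ v) = cong₂ _⊕_ (⊗-comm a b) (⟨⟩-comm u v)

  ⟨⟩-⊞ʳ : ∀ {k} (φ u v : V k) → ⟨ φ , u ⊞ v ⟩ ≡ ⟨ φ , u ⟩ ⊕ ⟨ φ , v ⟩
  ⟨⟩-⊞ʳ []      []      []      = sym (⊕-identityˡ 𝟎)
  ⟨⟩-⊞ʳ (a ∷ φ) (b ∷ u) (c ∷ v) = trans (cong (a ⊗ (b ⊕ c) ⊕_) (⟨⟩-⊞ʳ φ u v))
    (solve 5 (λ a b c s t → a :* (b :+ c) :+ (s :+ t) := (a :* b :+ s) :+ (a :* c :+ t)) refl
      a b c ⟨ φ , u ⟩ ⟨ φ , v ⟩)

  ⟨⟩-·ʳ : ∀ {k} (φ : V k) a v → ⟨ φ , a · v ⟩ ≡ a ⊗ ⟨ φ , v ⟩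
  ⟨⟩-·ʳ []      a []      = sym (⊗-zeroʳ a)
  ⟨⟩-·ʳ (b ∷ φ) a (c ∷ v) = trans (cong (b ⊗ (a ⊗ c) ⊕_) (⟨⟩-·ʳ φ a v))
    (solve 4 (λ a b c s → b :* (a :* c) :+ a :* s := a :* (b :* c :+ s)) refl a b c ⟨ φ , v ⟩)

  ⟨⟩-⊞·ʳ : ∀ {k} (φ u : V k) a v → ⟨ φ , u ⊞ a · v ⟩ ≡ ⟨ φ , u ⟩ ⊕ a ⊗ ⟨ φ , v ⟩
  ⟨⟩-⊞·ʳ φ u a v = trans (⟨⟩-⊞ʳ φ u (a · v)) (cong (⟨ φ , u ⟩ ⊕_) (⟨⟩-·ʳ φ a v))

  ⟨⟩-⊞·ˡ : ∀ {k} (φ : V k) a ψ v → ⟨ φ ⊞ a · ψ , v ⟩ ≡ ⟨ φ , v ⟩ ⊕ a ⊗ ⟨ ψ , v ⟩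
  ⟨⟩-⊞·ˡ φ a ψ v = trans (⟨⟩-comm (φ ⊞ a · ψ) v) (trans (⟨⟩-⊞·ʳ v φ a ψ)
    (cong₂ _⊕_ (⟨⟩-comm v φ) (cong (a ⊗_) (⟨⟩-comm v ψ))))

  ⟨⟩-𝟘ʳ : ∀ {k} (φ : V k) → ⟨ φ , 𝟘 ⟩ ≡ 𝟎
  ⟨⟩-𝟘ʳ []      = refl
  ⟨⟩-𝟘ʳ (a ∷ φ) = trans (cong₂ _⊕_ (⊗-zeroʳ a) (⟨⟩-𝟘ʳ φ)) (⊕-identityˡ 𝟎)

  ⊞-eq : ∀ {k} {u v : V k} → u ⊞ (⊖ 𝟏) · v ≡ 𝟘 → u ≡ v
  ⊞-eq {u = []}    {[]}    _  = refl
  ⊞-eq {u = a ∷ u} {b ∷ v} eq = cong₂ _∷_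
    (x∙y⁻¹≈ε⇒x≈y a b (trans (cong (a ⊕_) (sym (-1*x≈-x b))) (Vecₚ.∷-injectiveˡ eq)))
    (⊞-eq (Vecₚ.∷-injectiveʳ eq))

  ⟨⟩-injective : ∀ {k} (φ ψ : V k) → (∀ v → ⟨ φ , v ⟩ ≡ ⟨ ψ , v ⟩) → φ ≡ ψ
  ⟨⟩-injective []      []      _  = refl
  ⟨⟩-injective (a ∷ φ) (b ∷ ψ) eq = cong₂ _∷_
    (trans (sym (first a φ)) (trans (eq (𝟏 ∷ 𝟘)) (first b ψ)))
    (⟨⟩-injective φ ψ λ v → trans (sym (rest a φ v)) (trans (eq (𝟎 ∷ v)) (rest b ψ v)))
    where
    first : ∀ a φ → ⟨ a ∷ φ , 𝟏 ∷ 𝟘 ⟩ ≡ a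
    first a φ = trans (cong₂ _⊕_ (⊗-identityʳ a) (⟨⟩-𝟘ʳ φ)) (⊕-identityʳ a)
    rest : ∀ a φ v → ⟨ a ∷ φ , 𝟎 ∷ v ⟩ ≡ ⟨ φ , v ⟩
    rest a φ v = trans (cong (_⊕ ⟨ φ , v ⟩) (⊗-zeroʳ a)) (⊕-identityˡ ⟨ φ , v ⟩)

  ⊞-𝟎· : ∀ {k} (u v : V k) → u ⊞ 𝟎 · v ≡ u
  ⊞-𝟎· []      []      = refl
  ⊞-𝟎· (a ∷ u) (b ∷ v) = cong₂ _∷_ (trans (cong (a ⊕_) (⊗-zeroˡ b)) (⊕-identityʳ a)) (⊞-𝟎· u v)

  nz : K → ℕ
  nz a = χ (¬? (a ≟F 𝟎))

  nz-zero : ∀ {a} → a ≡ 𝟎 → nz a ≡ 0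
  nz-zero {a} a≡0 = χ-no (¬? (a ≟F 𝟎)) λ a≢0 → a≢0 a≡0

  nz-nonzero : ∀ {a} → a ≢ 𝟎 → nz a ≡ 1
  nz-nonzero {a} a≢0 = χ-yes (¬? (a ≟F 𝟎)) a≢0

  χ+nz : ∀ a → χ (a ≟F 𝟎) + nz a ≡ 1
  χ+nz a with a ≟F 𝟎
  ... | yes _ = refl
  ... | no  _ = refl

  -- The only solution is t = (c - a) / b.
  root-count : ∀ a b c → b ≢ 𝟎 → sum (λ t → χ (t ⊗ b ⊕ a ≟F c)) ≡ 1
  root-count a b c b≢0 with inverse b b≢0
  ... | b⁻¹ , bb⁻¹≡1 = trans (sum-cong λ t → χ-cong (t ⊗ b ⊕ a ≟F c) (t ≟F r) (to t) from) (sum-δ r)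
    where
    r : K
    r = (c ⊕ ⊖ a) ⊗ b⁻¹
    to : ∀ t → t ⊗ b ⊕ a ≡ c → t ≡ r
    to t refl = sym (trans (cong (_⊗ b⁻¹) (⊕-⊖-cancel (t ⊗ b) a)) (trans (⊗-assoc t b b⁻¹)
      (trans (cong (t ⊗_) bb⁻¹≡1) (⊗-identityʳ t))))
    from : ∀ {t} → t ≡ r → t ⊗ b ⊕ a ≡ c
    from refl = trans (cong (_⊕ a) (trans (solve 3 (λ d i b → (d :* i) :* b := d :* (b :* i)) refl (c ⊕ ⊖ a) b⁻¹ b)
      (trans (cong ((c ⊕ ⊖ a) ⊗_) bb⁻¹≡1) (⊗-identityʳ (c ⊕ ⊖ a))))) (⊖-⊕-cancel c a)

  nz-line : ∀ a b → b ≢ 𝟎 → sum (λ t → nz (a ⊕ t ⊗ b)) ≡ q′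
  nz-line a b b≢0 = suc-injective (begin
    suc (sum (λ t → nz (a ⊕ t ⊗ b)))   ≡⟨ cong (_+ sum (λ t → nz (a ⊕ t ⊗ b))) one ⟨
    sum (λ t → χ (a ⊕ t ⊗ b ≟F 𝟎)) + sum (λ t → nz (a ⊕ t ⊗ b))
      ≡⟨ sum-+ (λ t → χ (a ⊕ t ⊗ b ≟F 𝟎)) (λ t → nz (a ⊕ t ⊗ b)) ⟨
    sum (λ t → χ (a ⊕ t ⊗ b ≟F 𝟎) + nz (a ⊕ t ⊗ b)) ≡⟨ sum-cong (λ t → χ+nz (a ⊕ t ⊗ b)) ⟩
    sum {q} (λ _ → 1)                  ≡⟨ sum-const q 1 ⟩
    q * 1                              ≡⟨ *-identityʳ q ⟩
    q                                  ∎)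
    where
    open ≡-Reasoning
    one : sum (λ t → χ (a ⊕ t ⊗ b ≟F 𝟎)) ≡ 1
    one = trans (sum-cong λ t → cong (λ z → χ (z ≟F 𝟎)) (⊕-comm a (t ⊗ b))) (root-count a b 𝟎 b≢0)

  -- A code is presented by the list of its columns, read as functionals on messages; this is the
  -- Hamming weight of the codeword of message `y`.
  w : ∀ {k} → List (V k) → V k → ℕ
  w []      y = 0
  w (φ ∷ L) y = nz ⟨ φ , y ⟩ + w L y

  w-𝟘 : ∀ {k} (L : List (V k)) → w L 𝟘 ≡ 0
  w-𝟘 []      = refl
  w-𝟘 (φ ∷ L) = cong₂ _+_ (nz-zero (⟨⟩-𝟘ʳ φ)) (w-𝟘 L)

  killedBy : ∀ {k} → V k → List (V k) → List (V k)
  killedBy c = filter (λ φ → ⟨ φ , c ⟩ ≟F 𝟎)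

  -- Along the line y + t c a column killed by `c` is constant and is counted q times or never; any
  -- other column takes each field value once, so it is nonzero at exactly `q′` points.
  line-sum : ∀ {k} (L : List (V k)) y c →
             sum (λ t → w L (y ⊞ t · c)) ≡ q * w (killedBy c L) y + q′ * w L c
  line-sum [] y c = trans (sum-const q 0) (trans (*-zeroʳ q)
    (sym (cong₂ _+_ (*-zeroʳ q) (*-zeroʳ q′))))
  line-sum (φ ∷ L) y c = trans (sum-+ (λ t → nz ⟨ φ , y ⊞ t · c ⟩) (λ t → w L (y ⊞ t · c))) (split (⟨ φ , c ⟩ ≟F 𝟎))
    where
    a = ⟨ φ , y ⟩
    b = ⟨ φ , c ⟩
    rest : ℕ
    rest = sum (λ t → w L (y ⊞ t · c))
    expand : sum (λ t → nz ⟨ φ , y ⊞ t · c ⟩) ≡ sum (λ t → nz (a ⊕ t ⊗ b))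
    expand = sum-cong λ t → cong nz (⟨⟩-⊞·ʳ φ y t c)
    module N = +-*-Solver
    split : Dec (b ≡ 𝟎) → sum (λ t → nz ⟨ φ , y ⊞ t · c ⟩) + rest ≡
            q * w (killedBy c (φ ∷ L)) y + q′ * (nz b + w L c)
    split (yes b≡0) = begin
      sum (λ t → nz ⟨ φ , y ⊞ t · c ⟩) + rest
        ≡⟨ cong₂ _+_ (trans expand (trans (sum-cong λ t → cong nz (const t)) (sum-const q (nz a)))) (line-sum L y c) ⟩
      q * nz a + (q * w (killedBy c L) y + q′ * w L c)
        ≡⟨ N.solve 4 (λ Q n x z → Q N.:* n N.:+ (Q N.:* x N.:+ z) N.:= Q N.:* (n N.:+ x) N.:+ z) refl q (nz a) (w (killedBy c L) y) (q′ * w L c) ⟩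
      q * (nz a + w (killedBy c L) y) + q′ * w L c
        ≡⟨ cong₂ _+_ (cong (λ M → q * w M y) (filter-accept (λ φ → ⟨ φ , c ⟩ ≟F 𝟎) {φ} {L} b≡0)) (cong (λ z → q′ * (z + w L c)) (nz-zero b≡0)) ⟨
      q * w (killedBy c (φ ∷ L)) y + q′ * (nz b + w L c) ∎
      where
      open ≡-Reasoning
      const : ∀ t → a ⊕ t ⊗ b ≡ a
      const t = trans (cong (λ z → a ⊕ t ⊗ z) b≡0) (trans (cong (a ⊕_) (⊗-zeroʳ t)) (⊕-identityʳ a))
    split (no b≢0) = begin
      sum (λ t → nz ⟨ φ , y ⊞ t · c ⟩) + rest ≡⟨ cong₂ _+_ (trans expand (nz-line a b b≢0)) (line-sum L y c) ⟩
      q′ + (q * w (killedBy c L) y + q′ * w L c)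
        ≡⟨ N.solve 3 (λ Q x z → Q N.:+ (x N.:+ Q N.:* z) N.:= x N.:+ Q N.:* (N.con 1 N.:+ z)) refl q′ (q * w (killedBy c L) y) (w L c) ⟩
      q * w (killedBy c L) y + q′ * (1 + w L c)
        ≡⟨ cong₂ _+_ (cong (λ M → q * w M y) (filter-reject (λ φ → ⟨ φ , c ⟩ ≟F 𝟎) {φ} {L} b≢0)) (cong (λ z → q′ * (z + w L c)) (nz-nonzero b≢0)) ⟨
      q * w (killedBy c (φ ∷ L)) y + q′ * (nz b + w L c) ∎
      where open ≡-Reasoning

  -- If the first coordinate of `h` is nonzero, the first coordinate of `v` is determined by the
  -- others; otherwise it is free and the count reduces to the tail.
  hyperplane-count : ∀ {k} (h : V (suc k)) → h ≢ 𝟘 → ∀ c → sumV (λ v → χ (⟨ v , h ⟩ ≟F c)) ≡ q ^ k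
  hyperplane-count {k} (b ∷ h) h≢0 c with b ≟F 𝟎
  ... | no b≢0 = begin
    sumV (λ v → χ (⟨ v , b ∷ h ⟩ ≟F c))                      ≡⟨ sumV-∷ _ ⟩
    sum (λ t → sumV λ v → χ (t ⊗ b ⊕ ⟨ v , h ⟩ ≟F c))
      ≡⟨ sumV-sum (λ t v → χ (t ⊗ b ⊕ ⟨ v , h ⟩ ≟F c)) ⟨
    sumV (λ v → sum λ t → χ (t ⊗ b ⊕ ⟨ v , h ⟩ ≟F c))
      ≡⟨ sumV-cong (λ v → root-count ⟨ v , h ⟩ b c b≢0) ⟩
    sumV {q} {k} (λ _ → 1)                                   ≡⟨ sumV-const k 1 ⟩
    q ^ k * 1                                                ≡⟨ *-identityʳ (q ^ k) ⟩
    q ^ k                                                    ∎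
    where open ≡-Reasoning
  hyperplane-count {ℕ.zero} (b ∷ []) h≢0 c | yes refl = contradiction refl h≢0
  hyperplane-count {suc k} (b ∷ h) h≢0 c | yes refl = begin
    sumV (λ v → χ (⟨ v , 𝟎 ∷ h ⟩ ≟F c))                      ≡⟨ sumV-∷ _ ⟩
    sum (λ t → sumV λ v → χ (t ⊗ 𝟎 ⊕ ⟨ v , h ⟩ ≟F c))
      ≡⟨ sum-cong (λ t → sumV-cong λ v → cong (λ z → χ (z ≟F c)) (trans (cong (_⊕ ⟨ v , h ⟩) (⊗-zeroʳ t)) (⊕-identityˡ ⟨ v , h ⟩))) ⟩
    sum {q} (λ t → sumV λ v → χ (⟨ v , h ⟩ ≟F c))
      ≡⟨ sum-cong (λ _ → hyperplane-count h (λ { refl → h≢0 refl }) c) ⟩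
    sum {q} (λ t → q ^ k)                                    ≡⟨ sum-const q (q ^ k) ⟩
    q * q ^ k                                                ∎
    where open ≡-Reasoning

-- A second moment argument for vectors at which a set of functionals takes all values.

module SecondMoment (q′ : ℕ) (𝔽 : DiscreteField (suc q′)) where

  open DiscreteField 𝔽
  open LinearAlgebra q′ 𝔽

  card : ∀ {k} → (V k → Bool) → ℕ
  card A = sumV (toℕᵇ ∘ A)

  -- Distinct functionals agree on the hyperplane where their difference vanishes; equal ones agree
  -- on all q^(k+1) vectors, written as q^k + (q - 1) q^k.
  agreement-count : ∀ {k} (φ ψ : V (suc k)) →
    sumV (λ b → χ (⟨ φ , b ⟩ ≟F ⟨ ψ , b ⟩)) ≡ q ^ k + χ (φ ≟V ψ) * (q′ * q ^ k)
  agreement-count {k} φ ψ with φ ≟V ψ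
  ... | yes refl = begin
    sumV (λ b → χ (⟨ φ , b ⟩ ≟F ⟨ φ , b ⟩))  ≡⟨ sumV-cong (λ b → χ-yes (⟨ φ , b ⟩ ≟F ⟨ φ , b ⟩) refl) ⟩
    sumV {q} {suc k} (λ _ → 1)              ≡⟨ sumV-const (suc k) 1 ⟩
    q ^ suc k * 1                           ≡⟨ *-identityʳ _ ⟩
    q ^ k + q′ * q ^ k                      ≡⟨ cong (q ^ k +_) (+-identityʳ _) ⟨
    q ^ k + 1 * (q′ * q ^ k)                ∎
    where open ≡-Reasoning
  ... | no φ≢ψ = begin
    sumV (λ b → χ (⟨ φ , b ⟩ ≟F ⟨ ψ , b ⟩))
      ≡⟨ sumV-cong (λ b → χ-cong (⟨ φ , b ⟩ ≟F ⟨ ψ , b ⟩) (⟨ b , δ ⟩ ≟F 𝟎) (to b) (from b)) ⟩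
    sumV (λ b → χ (⟨ b , δ ⟩ ≟F 𝟎))                     ≡⟨ hyperplane-count δ (φ≢ψ ∘ ⊞-eq) 𝟎 ⟩
    q ^ k                                               ≡⟨ +-identityʳ _ ⟨
    q ^ k + 0                                           ∎
    where
    open ≡-Reasoning
    δ = φ ⊞ (⊖ 𝟏) · ψ
    expand : ∀ b → ⟨ b , δ ⟩ ≡ ⟨ φ , b ⟩ ⊕ ⊖ ⟨ ψ , b ⟩
    expand b = trans (⟨⟩-comm b δ) (trans (⟨⟩-⊞·ˡ φ (⊖ 𝟏) ψ b) (cong (⟨ φ , b ⟩ ⊕_) (-1*x≈-x ⟨ ψ , b ⟩)))
    to : ∀ b → ⟨ φ , b ⟩ ≡ ⟨ ψ , b ⟩ → ⟨ b , δ ⟩ ≡ 𝟎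
    to b eq = trans (expand b) (trans (cong (λ z → z ⊕ ⊖ ⟨ ψ , b ⟩) eq) (⊖-inverseʳ ⟨ ψ , b ⟩))
    from : ∀ b → ⟨ b , δ ⟩ ≡ 𝟎 → ⟨ φ , b ⟩ ≡ ⟨ ψ , b ⟩
    from b eq = x∙y⁻¹≈ε⇒x≈y _ _ (trans (sym (expand b)) eq)

  module _ {k} (A : V (suc k) → Bool) where

    private
      a : V (suc k) → ℕ
      a ψ = toℕᵇ (A ψ)

      a*a : ∀ ψ → a ψ * a ψ ≡ a ψ
      a*a ψ with A ψ
      ... | true  = refl
      ... | false = refl

      n : ℕ
      n = card A

    fibre : V (suc k) → K → ℕ
    fibre b c = sumV λ ψ → a ψ * χ (⟨ ψ , b ⟩ ≟F c)

    -- Groups a sum over `A` by the value at `b`.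
    fibre-sum* : ∀ b (f : K → ℕ) → sum (λ c → fibre b c * f c) ≡ sumV (λ ψ → a ψ * f ⟨ ψ , b ⟩)
    fibre-sum* b f = begin
      sum (λ c → fibre b c * f c)
        ≡⟨ sum-cong (λ c → trans (*-comm (fibre b c) (f c)) (sym (sumV-*ˡ (f c) _))) ⟩
      sum (λ c → sumV λ ψ → f c * (a ψ * χ (⟨ ψ , b ⟩ ≟F c)))
        ≡⟨ sumV-sum (λ c ψ → f c * (a ψ * χ (⟨ ψ , b ⟩ ≟F c))) ⟨
      sumV (λ ψ → sum λ c → f c * (a ψ * χ (⟨ ψ , b ⟩ ≟F c)))
        ≡⟨ sumV-cong (λ ψ → sum-cong λ c → rotate (f c) (a ψ) (χ (⟨ ψ , b ⟩ ≟F c))) ⟩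
      sumV (λ ψ → sum λ c → a ψ * (χ (⟨ ψ , b ⟩ ≟F c) * f c))
        ≡⟨ sumV-cong (λ ψ → trans (sum-*ˡ (a ψ) _) (cong (a ψ *_) (sum-δ* ⟨ ψ , b ⟩ f))) ⟩
      sumV (λ ψ → a ψ * f ⟨ ψ , b ⟩)                     ∎
      where
      open ≡-Reasoning
      rotate : ∀ x y z → x * (y * z) ≡ y * (z * x)
      rotate x y z = trans (*-comm x (y * z)) (*-assoc y z x)

    fibre-sum : ∀ b → sum (fibre b) ≡ n
    fibre-sum b = trans (sum-cong λ c → sym (*-identityʳ (fibre b c)))
      (trans (fibre-sum* b (λ _ → 1)) (sumV-cong λ ψ → *-identityʳ (a ψ)))

    private
      -- The left side counts triples of a vector `b` and two members of `A` that agree at `b`.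
      -- Exchanging the sums reduces it to `agreement-count`.
      second-moment : sumV (λ b → sum λ c → fibre b c * fibre b c) ≡ q ^ k * (n * n) + (q′ * q ^ k) * n
      second-moment = begin
        sumV (λ b → sum λ c → fibre b c * fibre b c)
          ≡⟨ sumV-cong (λ b → fibre-sum* b (fibre b)) ⟩
        sumV (λ b → sumV λ ψ → a ψ * fibre b ⟨ ψ , b ⟩)             ≡⟨ sumV-comm _ ⟩
        sumV (λ ψ → sumV λ b → a ψ * fibre b ⟨ ψ , b ⟩)
          ≡⟨ sumV-cong (λ ψ → trans (sumV-*ˡ (a ψ) _) (cong (a ψ *_) (inner ψ))) ⟩
        sumV (λ ψ → a ψ * (q ^ k * n + (q′ * q ^ k) * a ψ))
          ≡⟨ sumV-cong (λ ψ → trans (*-distribˡ-+ (a ψ) _ _) (cong₂ _+_ (swap (a ψ) (q ^ k * n)) (square ψ))) ⟩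
        sumV (λ ψ → (q ^ k * n) * a ψ + (q′ * q ^ k) * a ψ)         ≡⟨ sumV-+ _ _ ⟩
        sumV (λ ψ → (q ^ k * n) * a ψ) + sumV (λ ψ → (q′ * q ^ k) * a ψ)
          ≡⟨ cong₂ _+_ (sumV-*ˡ (q ^ k * n) a) (sumV-*ˡ (q′ * q ^ k) a) ⟩
        (q ^ k * n) * n + (q′ * q ^ k) * n
          ≡⟨ cong (_+ (q′ * q ^ k) * n) (*-assoc (q ^ k) n n) ⟩
        q ^ k * (n * n) + (q′ * q ^ k) * n                          ∎
        where
        open ≡-Reasoning
        swap : ∀ x y → x * y ≡ y * x
        swap = *-comm
        square : ∀ ψ → a ψ * ((q′ * q ^ k) * a ψ) ≡ (q′ * q ^ k) * a ψ
        square ψ = trans (swap (a ψ) _) (trans (*-assoc (q′ * q ^ k) (a ψ) (a ψ)) (cong ((q′ * q ^ k) *_) (a*a ψ)))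
        inner : ∀ ψ → sumV (λ b → fibre b ⟨ ψ , b ⟩) ≡ q ^ k * n + (q′ * q ^ k) * a ψ
        inner ψ = begin
          sumV (λ b → sumV λ φ → a φ * χ (⟨ φ , b ⟩ ≟F ⟨ ψ , b ⟩))  ≡⟨ sumV-comm _ ⟩
          sumV (λ φ → sumV λ b → a φ * χ (⟨ φ , b ⟩ ≟F ⟨ ψ , b ⟩))
            ≡⟨ sumV-cong (λ φ → trans (sumV-*ˡ (a φ) _) (cong (a φ *_) (agreement-count φ ψ))) ⟩
          sumV (λ φ → a φ * (q ^ k + χ (φ ≟V ψ) * (q′ * q ^ k)))
            ≡⟨ sumV-cong (λ φ → regroup (a φ) (q ^ k) (χ (φ ≟V ψ)) (q′ * q ^ k)) ⟩
          sumV (λ φ → q ^ k * a φ + (q′ * q ^ k) * (χ (φ ≟V ψ) * a φ)) ≡⟨ sumV-+ _ _ ⟩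
          sumV (λ φ → q ^ k * a φ) + sumV (λ φ → (q′ * q ^ k) * (χ (φ ≟V ψ) * a φ))
            ≡⟨ cong₂ _+_ (sumV-*ˡ (q ^ k) a) (trans (sumV-*ˡ (q′ * q ^ k) _) (cong ((q′ * q ^ k) *_) (sumV-δ ψ a))) ⟩
          q ^ k * n + (q′ * q ^ k) * a ψ                            ∎
          where
          regroup : ∀ x y z t → x * (y + z * t) ≡ y * x + t * (z * x)
          regroup = solve 4 (λ x y z t → x :* (y :+ z :* t) := y :* x :+ t :* (z :* x)) refl
            where open +-*-Solver

    Attains : V (suc k) → K → Set
    Attains b c = ∃ λ ψ → A ψ ≡ true × ⟨ ψ , b ⟩ ≡ c

    attains? : ∀ b c → Dec (Attains b c)
    attains? b c = ∃V? λ ψ → (A ψ Bool.≟ true) ×-dec (⟨ ψ , b ⟩ ≟F c)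

    private
      empty-fibre : ∀ b c → ¬ Attains b c → fibre b c ≡ 0
      empty-fibre b c ¬att = trans (sumV-cong vanish) (trans (sumV-const (suc k) 0) (*-zeroʳ (q ^ suc k)))
        where
        vanish : ∀ ψ → a ψ * χ (⟨ ψ , b ⟩ ≟F c) ≡ 0
        vanish ψ with A ψ in Aψ | ⟨ ψ , b ⟩ ≟F c
        ... | false | _      = refl
        ... | true  | yes eq = contradiction (ψ , Aψ , eq) ¬att
        ... | true  | no _   = refl

      -- If every `b` misses a value, at most q - 1 fibres are nonempty and Cauchy-Schwarz gives n²
      -- ≤ (q - 1) Σ fibre². Summing over all `b` and inserting the second moment yields q n² ≤ (q -
      -- 1)(n² + (q - 1) n).
      bounded : (∀ b → ∃ λ c → ¬ Attains b c) → n ≤ q′ * q′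
      bounded missing with n in n≡
      ... | 0 = z≤n
      -- Both sides contain `q′` n²; without it n² ≤ n (q - 1)² remains, and n is nonzero here.
      ... | suc m = *-cancelˡ-≤ (suc m) (+-cancelˡ-≤ (q′ * (suc m * suc m)) _ _ (begin
        q′ * (suc m * suc m) + suc m * suc m            ≡⟨ +-comm (q′ * (suc m * suc m)) (suc m * suc m) ⟩
        q * (suc m * suc m)                             ≤⟨ *-cancelˡ-≤ (q ^ k) {{m^n≢0 q k}} averaged ⟩
        q′ * (suc m * suc m + q′ * suc m)               ≡⟨ arith q′ (suc m) ⟩
        q′ * (suc m * suc m) + suc m * (q′ * q′)        ∎))
        where
        open ≤-Reasoning
        arith : ∀ x y → x * (y * y + x * y) ≡ x * (y * y) + y * (x * x)
        arith = solve 2 (λ x y → x :* (y :* y :+ x :* y) := x :* (y :* y) :+ y :* (x :* x)) refl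
          where open +-*-Solver
        pointwise : ∀ b → n * n ≤ q′ * sum (λ c → fibre b c * fibre b c)
        pointwise b with missing b
        ... | c , ¬att = subst (λ z → z * z ≤ q′ * sum (λ c → fibre b c * fibre b c)) (fibre-sum b)
          (cauchy-schwarz-missing (fibre b) c (empty-fibre b c ¬att))
        averaged : q ^ k * (q * (suc m * suc m)) ≤ q ^ k * (q′ * (suc m * suc m + q′ * suc m))
        averaged = subst (λ z → q ^ k * (q * (z * z)) ≤ q ^ k * (q′ * (z * z + q′ * z))) n≡ (begin
          q ^ k * (q * (n * n))                             ≡⟨ *-assoc (q ^ k) q (n * n) ⟨
          (q ^ k * q) * (n * n)                             ≡⟨ cong (_* (n * n)) (*-comm (q ^ k) q) ⟩
          q ^ suc k * (n * n)                               ≡⟨ sumV-const (suc k) (n * n) ⟨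
          sumV {q} {suc k} (λ b → n * n)                    ≤⟨ sumV-mono pointwise ⟩
          sumV (λ b → q′ * sum λ c → fibre b c * fibre b c) ≡⟨ sumV-*ˡ q′ _ ⟩
          q′ * sumV (λ b → sum λ c → fibre b c * fibre b c) ≡⟨ cong (q′ *_) second-moment ⟩
          q′ * (q ^ k * (n * n) + (q′ * q ^ k) * n)         ≡⟨ rearrange q′ (q ^ k) n ⟩
          q ^ k * (q′ * (n * n + q′ * n))                   ∎)
          where
          rearrange : ∀ x y z → x * (y * (z * z) + (x * y) * z) ≡ y * (x * (z * z + x * z))
          rearrange = solve 3 (λ x y z → x :* (y :* (z :* z) :+ (x :* y) :* z) := y :* (x :* (z :* z :+ x :* z))) refl
            where open +-*-Solver

    surjective-functional : q * q ≤ n → ∃ λ b → ∀ c → Attains b c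
    surjective-functional q²≤n with ∃V? (λ b → allF? (attains? b))
    ... | yes p = p
    ... | no ¬p = contradiction
      (bounded λ b → ¬∀⟶∃¬ q _ (attains? b) λ all → ¬p (b , all))
      (<⇒≱ (<-≤-trans (*-mono-< (n<1+n q′) (n<1+n q′)) q²≤n))

-- Polynomial functions of bounded degree and their zeros.

module PolynomialFunctions (q′ : ℕ) (𝔽 : DiscreteField (suc q′)) where

  open DiscreteField 𝔽
  open LinearAlgebra q′ 𝔽
  open SecondMoment q′ 𝔽
  open RingSolver commutativeSemiring using (solve; _:=_; _:+_; _:*_; con)
  open SemiringMult semiring using (×-homo-+) renaming (_×_ to _×ᶠ_)

  _∖_ : ∀ {k} → (V k → Bool) → V k → V k → Bool
  (A ∖ ψ) φ = A φ ∧ not (does (φ ≟V ψ))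

  ∖-sound : ∀ {k} (A : V k → Bool) ψ {φ} → (A ∖ ψ) φ ≡ true → A φ ≡ true × φ ≢ ψ
  ∖-sound A ψ {φ} eq with A φ | φ ≟V ψ
  ∖-sound A ψ {φ} eq | true  | no φ≢ψ = refl , φ≢ψ
  ∖-sound A ψ {φ} () | true  | yes _
  ∖-sound A ψ {φ} () | false | _

  card-∖ : ∀ {k} (A : V k → Bool) ψ → card A ≤ suc (card (A ∖ ψ))
  card-∖ A ψ = begin
    card A                                                    ≤⟨ sumV-mono pointwise ⟩
    sumV (λ φ → χ (φ ≟V ψ) * 1 + toℕᵇ ((A ∖ ψ) φ))            ≡⟨ sumV-+ _ _ ⟩
    sumV (λ φ → χ (φ ≟V ψ) * 1) + card (A ∖ ψ)                ≡⟨ cong (_+ card (A ∖ ψ)) (sumV-δ ψ (λ _ → 1)) ⟩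
    suc (card (A ∖ ψ))                                        ∎
    where
    open ≤-Reasoning
    pointwise : ∀ φ → toℕᵇ (A φ) ≤ χ (φ ≟V ψ) * 1 + toℕᵇ ((A ∖ ψ) φ)
    pointwise φ with A φ | φ ≟V ψ
    ... | false | _     = z≤n
    ... | true  | yes _ = ≤-refl
    ... | true  | no _  = ≤-refl

  member : ∀ {k} (A : V k → Bool) → 1 ≤ card A → ∃ λ ψ → A ψ ≡ true
  member A 1≤ with sumV-positive (toℕᵇ ∘ A) 1≤
  ... | ψ , 1≤Aψ = ψ , true! (A ψ) 1≤Aψ
    where
    true! : ∀ b → 1 ≤ toℕᵇ b → b ≡ true
    true! true _ = refl

  -- Functions of degree at most the index, generated by constants, sums and multiplication by an
  -- affine function. Closure under pointwise equality is built in by `ext`.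
  data Poly {k} : ℕ → (V k → K) → Set where
    const : ∀ {s} c → Poly s (λ _ → c)
    add   : ∀ {s f g} → Poly s f → Poly s g → Poly s (λ y → f y ⊕ g y)
    mul   : ∀ {s f} φ b → Poly s f → Poly (suc s) (λ y → (⟨ φ , y ⟩ ⊕ b) ⊗ f y)
    ext   : ∀ {s f g} → (∀ y → f y ≡ g y) → Poly s f → Poly s g

  module _ {k : ℕ} where

    scale : ∀ {s} {f : V k → K} c → Poly s f → Poly s (λ y → c ⊗ f y)
    scale c (const d)   = const (c ⊗ d)
    scale c (add f g)   = ext (λ y → sym (⊗-distribˡ c _ _)) (add (scale c f) (scale c g))
    scale c (mul φ b f) = ext (λ y → solve 3 (λ c l f → l :* (c :* f) := c :* (l :* f)) refl c _ _) (mul φ b (scale c f))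
    scale c (ext eq f)  = ext (λ y → cong (c ⊗_) (eq y)) (scale c f)

    Poly₀-constant : ∀ {f : V k → K} → Poly 0 f → ∀ y z → f y ≡ f z
    Poly₀-constant (const c)  y z = refl
    Poly₀-constant (add f g)  y z = cong₂ _⊕_ (Poly₀-constant f y z) (Poly₀-constant g y z)
    Poly₀-constant (ext eq f) y z = trans (sym (eq y)) (trans (Poly₀-constant f y z) (eq z))

    -- On a line each affine factor becomes affine in the parameter, so the degree bound survives
    -- and questions reduce to one variable.
    onLine : ∀ {s} {f : V k → K} y z → Poly s f → Poly {1} s (λ t → f (y ⊞ head t · z))
    onLine y z (const c)   = const c
    onLine y z (add f g)   = add (onLine y z f) (onLine y z g)
    onLine y z (mul {f = f} φ b p) = ext (λ { (t ∷ []) → cong (_⊗ f (y ⊞ t · z)) (coordinate t) })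
      (mul (⟨ φ , z ⟩ ∷ []) (⟨ φ , y ⟩ ⊕ b) (onLine y z p))
      where
      coordinate : ∀ t → (⟨ φ , z ⟩ ⊗ t ⊕ 𝟎) ⊕ (⟨ φ , y ⟩ ⊕ b) ≡ ⟨ φ , y ⊞ t · z ⟩ ⊕ b
      coordinate t = trans (solve 4 (λ z t y b → (z :* t :+ con 0) :+ (y :+ b) := (y :+ t :* z) :+ b) refl
        ⟨ φ , z ⟩ t ⟨ φ , y ⟩ b) (cong (_⊕ b) (sym (⟨⟩-⊞·ʳ φ y t z)))
    onLine y z (ext eq f)  = ext (λ t → eq (y ⊞ head t · z)) (onLine y z f)

    -- Division by the affine function ℓ y = ⟨ψ, y⟩ + c: moving along x, on which ψ is 1,
    -- takes y into the zero set of ℓ.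
    module Division (ψ x : V k) (ψx≡1 : ⟨ ψ , x ⟩ ≡ 𝟏) (c : K) where

      ℓ : V k → K
      ℓ y = ⟨ ψ , y ⟩ ⊕ c

      π : V k → V k
      π y = y ⊞ (⊖ ℓ y) · x

      functional-π : ∀ φ y → ⟨ φ , y ⟩ ≡ ⟨ φ , π y ⟩ ⊕ ℓ y ⊗ ⟨ φ , x ⟩
      functional-π φ y = sym (begin
        ⟨ φ , π y ⟩ ⊕ ℓ y ⊗ ⟨ φ , x ⟩
          ≡⟨ cong (_⊕ ℓ y ⊗ ⟨ φ , x ⟩) (⟨⟩-⊞·ʳ φ y (⊖ ℓ y) x) ⟩
        (⟨ φ , y ⟩ ⊕ (⊖ ℓ y) ⊗ ⟨ φ , x ⟩) ⊕ ℓ y ⊗ ⟨ φ , x ⟩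
          ≡⟨ cong (λ z → (⟨ φ , y ⟩ ⊕ z) ⊕ ℓ y ⊗ ⟨ φ , x ⟩) (sym (-‿distribˡ-* (ℓ y) ⟨ φ , x ⟩)) ⟩
        (⟨ φ , y ⟩ ⊕ ⊖ (ℓ y ⊗ ⟨ φ , x ⟩)) ⊕ ℓ y ⊗ ⟨ φ , x ⟩    ≡⟨ ⊖-⊕-cancel _ _ ⟩
        ⟨ φ , y ⟩                                              ∎)
        where open ≡-Reasoning

      ℓ-π : ∀ y → ℓ (π y) ≡ 𝟎
      ℓ-π y = begin
        ⟨ ψ , π y ⟩ ⊕ c                          ≡⟨ cong (_⊕ c) (⟨⟩-⊞·ʳ ψ y (⊖ ℓ y) x) ⟩
        (⟨ ψ , y ⟩ ⊕ (⊖ ℓ y) ⊗ ⟨ ψ , x ⟩) ⊕ c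
          ≡⟨ cong (λ z → (⟨ ψ , y ⟩ ⊕ z) ⊕ c) (trans (cong ((⊖ ℓ y) ⊗_) ψx≡1) (⊗-identityʳ _)) ⟩
        (⟨ ψ , y ⟩ ⊕ (⊖ ℓ y)) ⊕ c
          ≡⟨ solve 3 (λ a n c → (a :+ n) :+ c := (a :+ c) :+ n) refl ⟨ ψ , y ⟩ (⊖ ℓ y) c ⟩
        ℓ y ⊕ ⊖ ℓ y                              ≡⟨ ⊖-inverseʳ (ℓ y) ⟩
        𝟎                                        ∎
        where open ≡-Reasoning

      -- The function φ(π y) = φ(y) - φ(x) ℓ(y) is again affine, so multiplying by it costs one
      -- degree.
      affine-π : ∀ {s f} φ b → Poly s f → Poly (suc s) (λ y → (⟨ φ , π y ⟩ ⊕ b) ⊗ f y)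
      affine-π {f = f} φ b p = ext (λ y → cong (_⊗ f y) (same y))
        (mul (φ ⊞ (⊖ ⟨ φ , x ⟩) · ψ) (b ⊕ (⊖ ⟨ φ , x ⟩) ⊗ c) p)
        where
        open ≡-Reasoning
        m = ⊖ ⟨ φ , x ⟩
        same : ∀ y → ⟨ φ ⊞ m · ψ , y ⟩ ⊕ (b ⊕ m ⊗ c) ≡ ⟨ φ , π y ⟩ ⊕ b
        same y = begin
          ⟨ φ ⊞ m · ψ , y ⟩ ⊕ (b ⊕ m ⊗ c)                ≡⟨ cong (_⊕ (b ⊕ m ⊗ c)) (⟨⟩-⊞·ˡ φ m ψ y) ⟩
          (⟨ φ , y ⟩ ⊕ m ⊗ ⟨ ψ , y ⟩) ⊕ (b ⊕ m ⊗ c)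
            ≡⟨ solve 5 (λ u m v b c → (u :+ m :* v) :+ (b :+ m :* c) := (u :+ m :* (v :+ c)) :+ b) refl ⟨ φ , y ⟩ m ⟨ ψ , y ⟩ b c ⟩
          (⟨ φ , y ⟩ ⊕ m ⊗ ℓ y) ⊕ b
            ≡⟨ cong (λ z → (⟨ φ , y ⟩ ⊕ z) ⊕ b) (trans (sym (-‿distribˡ-* ⟨ φ , x ⟩ (ℓ y))) (trans (cong ⊖_ (⊗-comm ⟨ φ , x ⟩ (ℓ y))) (-‿distribˡ-* (ℓ y) ⟨ φ , x ⟩))) ⟩
          (⟨ φ , y ⟩ ⊕ (⊖ ℓ y) ⊗ ⟨ φ , x ⟩) ⊕ b          ≡⟨ cong (_⊕ b) (⟨⟩-⊞·ʳ φ y (⊖ ℓ y) x) ⟨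
          ⟨ φ , π y ⟩ ⊕ b                                ∎

      -- Division with remainder f ∘ π, by induction on the construction of f. For a product (φ + b)
      -- f with f(y) = f(π y) + ℓ(y) g(y), the quotient is φ(x) f(y) + (φ(π y) + b) g(y); when f has
      -- degree 0 it is constant and the second summand disappears.
      divide : ∀ {s f} → Poly (suc s) f → ∃ λ g → Poly s g × (∀ y → f y ≡ f (π y) ⊕ ℓ y ⊗ g y)
      divide (const d) = (λ _ → 𝟎) , const 𝟎 , λ y → sym (trans (cong (d ⊕_) (⊗-zeroʳ (ℓ y))) (⊕-identityʳ d))
      divide (add {f = f₁} {g = f₂} p₁ p₂) with divide p₁ | divide p₂
      ... | g₁ , r₁ , eq₁ | g₂ , r₂ , eq₂ = (λ y → g₁ y ⊕ g₂ y) , add r₁ r₂ , λ y →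
        trans (cong₂ _⊕_ (eq₁ y) (eq₂ y))
          (solve 5 (λ a b l g h → (a :+ l :* g) :+ (b :+ l :* h) := (a :+ b) :+ l :* (g :+ h)) refl
            (f₁ (π y)) (f₂ (π y)) (ℓ y) (g₁ y) (g₂ y))
      divide (ext eq p) with divide p
      ... | g , r , eq′ = g , r , λ y → trans (sym (eq y)) (trans (eq′ y) (cong (_⊕ ℓ y ⊗ g y) (eq (π y))))
      divide (mul {zero} {f} φ b p) = (λ y → ⟨ φ , x ⟩ ⊗ f y) , scale ⟨ φ , x ⟩ p , λ y →
        trans (cong (λ z → (z ⊕ b) ⊗ f y) (functional-π φ y))
          (trans (solve 5 (λ u l v b f → ((u :+ l :* v) :+ b) :* f := (u :+ b) :* f :+ l :* (v :* f)) refl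
            ⟨ φ , π y ⟩ (ℓ y) ⟨ φ , x ⟩ b (f y))
            (cong (λ z → (⟨ φ , π y ⟩ ⊕ b) ⊗ z ⊕ ℓ y ⊗ (⟨ φ , x ⟩ ⊗ f y)) (Poly₀-constant p y (π y))))
      divide (mul {suc s} {f} φ b p) with divide p
      ... | g , r , eq = (λ y → ⟨ φ , x ⟩ ⊗ f y ⊕ (⟨ φ , π y ⟩ ⊕ b) ⊗ g y) , add (scale ⟨ φ , x ⟩ p) (affine-π φ b r) , λ y →
        trans (cong (λ z → (z ⊕ b) ⊗ f y) (functional-π φ y))
          (trans (solve 5 (λ u l v b f → ((u :+ l :* v) :+ b) :* f := (u :+ b) :* f :+ l :* (v :* f)) refl
            ⟨ φ , π y ⟩ (ℓ y) ⟨ φ , x ⟩ b (f y))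
            (trans (cong (λ z → (⟨ φ , π y ⟩ ⊕ b) ⊗ z ⊕ ℓ y ⊗ (⟨ φ , x ⟩ ⊗ f y)) (eq y))
              (solve 6 (λ a h l g v f → a :* (h :+ l :* g) :+ l :* (v :* f) := a :* h :+ l :* (v :* f :+ a :* g)) refl
                (⟨ φ , π y ⟩ ⊕ b) (f (π y)) (ℓ y) (g y) ⟨ φ , x ⟩ (f y))))

  -- Factor theorem: dividing by t - r for a root r leaves a quotient of smaller degree that
  -- vanishes at the remaining roots.
  root-bound : ∀ {s f} → Poly {1} s f → (Z : V 1 → Bool) → suc s ≤ card Z →
               (∀ v → Z v ≡ true → f v ≡ 𝟎) → ∀ v → f v ≡ 𝟎
  root-bound {zero} p Z 1≤ f≡0 v with member Z 1≤
  ... | u , Zu = trans (Poly₀-constant p v u) (f≡0 u Zu)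
  root-bound {suc s} {f} p Z 2+s≤ f≡0 with member Z (≤-trans (s≤s z≤n) 2+s≤)
  ... | r ∷ [] , Zr = λ v → trans (f≡ℓg v) (trans (cong (ℓ v ⊗_) (g≡0 v)) (⊗-zeroʳ (ℓ v)))
    where
    -- With these choices ℓ is t - r, and the projection sends every point to r.
    open Division (𝟏 ∷ []) (𝟏 ∷ []) (trans (⊕-identityʳ _) (⊗-identityˡ 𝟏)) (⊖ r)
    g = proj₁ (divide p)
    ℓ≡ : ∀ t → ℓ (t ∷ []) ≡ t ⊕ ⊖ r
    ℓ≡ t = cong (_⊕ ⊖ r) (trans (⊕-identityʳ (𝟏 ⊗ t)) (⊗-identityˡ t))
    π≡r : ∀ v → π v ≡ r ∷ []
    π≡r (t ∷ []) = cong (_∷ []) (x∙y⁻¹≈ε⇒x≈y _ r (trans (sym (ℓ≡ (t ⊕ (⊖ ℓ (t ∷ [])) ⊗ 𝟏))) (ℓ-π (t ∷ []))))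
    f≡ℓg : ∀ v → f v ≡ ℓ v ⊗ g v
    f≡ℓg v = trans (proj₂ (proj₂ (divide p)) v) (trans (cong (λ z → z ⊕ ℓ v ⊗ g v)
      (trans (cong f (π≡r v)) (f≡0 (r ∷ []) Zr))) (⊕-identityˡ _))
    g-root : ∀ v → (Z ∖ (r ∷ [])) v ≡ true → g v ≡ 𝟎
    g-root v Z′v with ∖-sound Z (r ∷ []) Z′v
    g-root (t ∷ []) Z′v | Zv , v≢r = ⊗-cancelˡ (ℓ (t ∷ []))
      (λ ℓ≡0 → v≢r (cong (_∷ []) (x∙y⁻¹≈ε⇒x≈y t r (trans (sym (ℓ≡ t)) ℓ≡0))))
      (trans (sym (f≡ℓg (t ∷ []))) (trans (f≡0 (t ∷ []) Zv) (sym (⊗-zeroʳ _))))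
    g≡0 : ∀ v → g v ≡ 𝟎
    g≡0 = root-bound (proj₁ (proj₂ (divide p))) (Z ∖ (r ∷ [])) (≤-pred (≤-trans 2+s≤ (card-∖ Z (r ∷ [])))) g-root

  -- The q - 1 nonzero field elements are already more roots than the degree permits.
  vanishes-at-𝟘 : ∀ {s f} → Poly {1} s f → s < q′ → (∀ t → t ≢ 𝟎 → f (t ∷ []) ≡ 𝟎) → f 𝟘 ≡ 𝟎
  vanishes-at-𝟘 {s} {f} p s<q′ f≡0 = root-bound p nonzero enough zeros 𝟘
    where
    nonzero : V 1 → Bool
    nonzero = (λ _ → true) ∖ 𝟘
    enough : suc s ≤ card nonzero
    enough = ≤-trans s<q′ (≤-pred (subst (_≤ suc (card nonzero))
      (trans (sumV-const 1 1) (trans (*-identityʳ (q ^ 1)) (*-identityʳ q))) (card-∖ (λ _ → true) 𝟘)))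
    zeros : ∀ v → nonzero v ≡ true → f v ≡ 𝟎
    zeros v eq with ∖-sound (λ _ → true) 𝟘 {v} eq
    zeros (t ∷ []) eq | _ , v≢0 = f≡0 t λ t≡0 → v≢0 (cong (_∷ []) t≡0)

  -- Divide by one ψ of `A`: the remainder vanishes because π maps into ker ψ, and the quotient, of
  -- degree one less, vanishes on the hyperplanes of the other members. The normalisation at `x`
  -- makes distinct members non-proportional.
  vanishes-on-hyperplanes : ∀ {k s} {f : V k → K} x (A : V k → Bool) → Poly s f → s ≤ q′ → suc s ≤ card A →
    (∀ ψ → A ψ ≡ true → ⟨ ψ , x ⟩ ≡ 𝟏) →
    (∀ ψ → A ψ ≡ true → ∀ y → ⟨ ψ , y ⟩ ≡ 𝟎 → f y ≡ 𝟎) →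
    ∀ y → f y ≡ 𝟎
  vanishes-on-hyperplanes {s = zero} x A p s≤q′ 1≤ Ax f≡0 y with member A 1≤
  ... | ψ , Aψ = trans (Poly₀-constant p y 𝟘) (f≡0 ψ Aψ 𝟘 (⟨⟩-𝟘ʳ ψ))
  vanishes-on-hyperplanes {k} {suc s} {f} x A p s<q′ 2+s≤ Ax f≡0 with member A (≤-trans (s≤s z≤n) 2+s≤)
  ... | ψ , Aψ = λ y → trans (f≡ℓg y) (trans (cong (ℓ y ⊗_) (g≡0 y)) (⊗-zeroʳ (ℓ y)))
    where
    open Division ψ x (Ax ψ Aψ) 𝟎
    g = proj₁ (divide p)
    g-poly = proj₁ (proj₂ (divide p))
    ℓ≡ψ : ∀ y → ℓ y ≡ ⟨ ψ , y ⟩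
    ℓ≡ψ y = ⊕-identityʳ ⟨ ψ , y ⟩
    f≡ℓg : ∀ y → f y ≡ ℓ y ⊗ g y
    f≡ℓg y = trans (proj₂ (proj₂ (divide p)) y) (trans (cong (_⊕ ℓ y ⊗ g y)
      (f≡0 ψ Aψ (π y) (trans (sym (ℓ≡ψ (π y))) (ℓ-π y)))) (⊕-identityˡ _))
    g-off : ∀ φ → A φ ≡ true → ∀ y → ⟨ φ , y ⟩ ≡ 𝟎 → ⟨ ψ , y ⟩ ≢ 𝟎 → g y ≡ 𝟎
    g-off φ Aφ y φy≡0 ψy≢0 = ⊗-cancelˡ (ℓ y) (λ ℓ≡0 → ψy≢0 (trans (sym (ℓ≡ψ y)) ℓ≡0))
      (trans (sym (f≡ℓg y)) (trans (f≡0 φ Aφ y φy≡0) (sym (⊗-zeroʳ (ℓ y)))))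
    -- On the intersection of the two hyperplanes, move inside ker φ along a line that leaves ker ψ.
    g-on : ∀ φ → (A ∖ ψ) φ ≡ true → ∀ y → ⟨ φ , y ⟩ ≡ 𝟎 → g y ≡ 𝟎
    g-on φ A′φ y φy≡0 with ∖-sound A ψ A′φ | ⟨ ψ , y ⟩ ≟F 𝟎
    ... | Aφ , φ≢ψ | no ψy≢0 = g-off φ Aφ y φy≡0 ψy≢0
    ... | Aφ , φ≢ψ | yes ψy≡0 with separate
      where
      separate : ∃ λ z → ⟨ φ , z ⟩ ≡ 𝟎 × ⟨ ψ , z ⟩ ≢ 𝟎
      separate with ∃V? (λ v → ¬? (⟨ φ , v ⟩ ≟F ⟨ ψ , v ⟩))
      ... | no ¬p = contradiction (⟨⟩-injective φ ψ λ v → agree v (⟨ φ , v ⟩ ≟F ⟨ ψ , v ⟩)) φ≢ψ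
        where
        agree : ∀ v → Dec (⟨ φ , v ⟩ ≡ ⟨ ψ , v ⟩) → ⟨ φ , v ⟩ ≡ ⟨ ψ , v ⟩
        agree v (yes eq) = eq
        agree v (no neq) = contradiction (v , neq) ¬p
      -- The witness is v - φ(v) x: since φ and ψ are 1 at x, it has value 0 under φ and ψ(v) - φ(v)
      -- under ψ.
      ... | yes (v , φv≢ψv) = v ⊞ (⊖ ⟨ φ , v ⟩) · x , along φ Aφ (⊖-inverseʳ ⟨ φ , v ⟩) , λ ψz≡0 →
        φv≢ψv (sym (x∙y⁻¹≈ε⇒x≈y ⟨ ψ , v ⟩ ⟨ φ , v ⟩ (trans (sym (along ψ Aψ refl)) ψz≡0)))
        where
        along : ∀ θ → A θ ≡ true → ∀ {r} → ⟨ θ , v ⟩ ⊕ ⊖ ⟨ φ , v ⟩ ≡ r → ⟨ θ , v ⊞ (⊖ ⟨ φ , v ⟩) · x ⟩ ≡ r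
        along θ Aθ eq = trans (⟨⟩-⊞·ʳ θ v (⊖ ⟨ φ , v ⟩) x) (trans (cong (⟨ θ , v ⟩ ⊕_)
          (trans (cong ((⊖ ⟨ φ , v ⟩) ⊗_) (Ax θ Aθ)) (⊗-identityʳ _))) eq)
    ... | z , φz≡0 , ψz≢0 = trans (cong g (sym (⊞-𝟎· y z))) (vanishes-at-𝟘 (onLine y z g-poly) s<q′ λ t t≢0 →
      g-off φ Aφ (y ⊞ t · z)
        (trans (⟨⟩-⊞·ʳ φ y t z) (trans (cong₂ _⊕_ φy≡0 (trans (cong (t ⊗_) φz≡0) (⊗-zeroʳ t))) (⊕-identityˡ 𝟎)))
        (λ eq → ⊗-nonzero t≢0 ψz≢0 (trans (sym (trans (cong (_⊕ t ⊗ ⟨ ψ , z ⟩) ψy≡0) (⊕-identityˡ _)))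
          (trans (sym (⟨⟩-⊞·ʳ ψ y t z)) eq))))
    g≡0 : ∀ y → g y ≡ 𝟎
    g≡0 = vanishes-on-hyperplanes x (A ∖ ψ) g-poly (<⇒≤ s<q′) (≤-pred (≤-trans 2+s≤ (card-∖ A ψ)))
      (λ φ A′φ → Ax φ (proj₁ (∖-sound A ψ A′φ))) g-on

  -- The canonical image of a natural number in the field; it turns weights modulo p into
  -- field-valued functions.
  ν : ℕ → K
  ν n = n ×ᶠ 𝟏

  product : ∀ n → (Fin n → K) → K → K
  product zero    β a = 𝟏
  product (suc n) β a = (a ⊕ ⊖ β zero) ⊗ product n (β ∘ suc) a

  product-root : ∀ n (β : Fin n → K) i → product n β (β i) ≡ 𝟎
  product-root (suc n) β zero    = trans (cong (_⊗ product n (β ∘ suc) (β zero)) (⊖-inverseʳ (β zero))) (⊗-zeroˡ _)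
  product-root (suc n) β (suc i) = trans (cong ((β (suc i) ⊕ ⊖ β zero) ⊗_) (product-root n (β ∘ suc) i)) (⊗-zeroʳ _)

  product-nonzero : ∀ n (β : Fin n → K) a → (∀ i → a ≢ β i) → product n β a ≢ 𝟎
  product-nonzero zero    β a a≢β = λ 1≡0 → 𝟎≢𝟏 (sym 1≡0)
  product-nonzero (suc n) β a a≢β = ⊗-nonzero (λ eq → a≢β zero (x∙y⁻¹≈ε⇒x≈y a (β zero) eq))
    (product-nonzero n (β ∘ suc) a (a≢β ∘ suc))

  product-poly : ∀ {k} n (β : Fin n → K) (φ : V k) → Poly n (λ y → product n β ⟨ φ , y ⟩)
  product-poly zero    β φ = const 𝟏
  product-poly (suc n) β φ = mul φ (⊖ β zero) (product-poly n (β ∘ suc) φ)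

  -- The indicator of a ≠ 0 is 1 - P a / P 0, where P is the product of the q - 1 factors a - β with β ≠ 0.
  nz-poly : ∀ {k} (φ : V k) → Poly q′ (λ y → ν (nz ⟨ φ , y ⟩))
  nz-poly φ with inverse (product q′ (punchIn 𝟎) 𝟎) (product-nonzero q′ (punchIn 𝟎) 𝟎 λ i eq → punchInᵢ≢i 𝟎 i (sym eq))
  ... | κ , Pκ≡1 = ext (λ y → interpolate ⟨ φ , y ⟩) (add (const 𝟏) (scale (⊖ κ) (product-poly q′ (punchIn 𝟎) φ)))
    where
    interpolate : ∀ a → 𝟏 ⊕ (⊖ κ) ⊗ product q′ (punchIn 𝟎) a ≡ ν (nz a)
    interpolate a with a ≟F 𝟎
    ... | yes refl = trans (cong (𝟏 ⊕_) (trans (sym (-‿distribˡ-* κ _)) (cong ⊖_ (trans (⊗-comm κ _) Pκ≡1)))) (⊖-inverseʳ 𝟏)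
    ... | no a≢0 = cong (𝟏 ⊕_) (trans (cong ((⊖ κ) ⊗_) (trans (cong (product q′ (punchIn 𝟎)) (sym (punchIn-punchOut (a≢0 ∘ sym))))
      (product-root q′ (punchIn 𝟎) (punchOut (a≢0 ∘ sym))))) (⊗-zeroʳ (⊖ κ)))

  -- Adding indicator functions does not raise the degree, so the bound is independent of the length
  -- of `L`.
  weight-poly : ∀ {k} (L : List (V k)) → Poly q′ (λ y → ν (w L y))
  weight-poly []      = const 𝟎
  weight-poly (φ ∷ L) = ext (λ y → sym (×-homo-+ 𝟏 (nz ⟨ φ , y ⟩) (w L y))) (add (nz-poly φ) (weight-poly L))

-- The characteristic, and divisibility spreading from hyperplanes to a point.

module Spreading (q′ : ℕ) (𝔽 : DiscreteField (suc q′))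
  (p f : ℕ) (p-prime : Prime p) (q≡p^f : suc q′ ≡ p ^ f) where

  open DiscreteField 𝔽
  open LinearAlgebra q′ 𝔽
  open SecondMoment q′ 𝔽
  open PolynomialFunctions q′ 𝔽
  open SemiringMult semiring using (×1-homo-*)
  private module ∑ = CommutativeMonoidSum +-commutativeMonoid

  -- Translation by 1 permutes the field, so the sum of all elements is unchanged when q ones are
  -- added to it.
  ν-q : ν q ≡ 𝟎
  ν-q = identityʳ-unique (∑.sum (λ a → a)) (ν q) (begin
    ∑.sum {q} (λ a → a) ⊕ ν q                    ≡⟨ cong (∑.sum {q} (λ a → a) ⊕_) (∑.sum-replicate q) ⟨
    ∑.sum {q} (λ a → a) ⊕ ∑.sum {q} (λ _ → 𝟏)    ≡⟨ ∑.∑-distrib-+ {q} (λ a → a) (λ _ → 𝟏) ⟨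
    ∑.sum {q} (λ a → a ⊕ 𝟏)                      ≡⟨ ∑.sum-permute {q} (λ a → a) shift ⟨
    ∑.sum {q} (λ a → a)                          ∎)
    where
    open ≡-Reasoning
    shift : Permutation′ q
    shift = permutation (_⊕ 𝟏) (_⊕ ⊖ 𝟏) (λ a → ⊖-⊕-cancel a 𝟏) (λ a → ⊕-⊖-cancel a 𝟏)

  -- The image of q is a power of the image of p, and a field has no zero divisors.
  ν-p : ν p ≡ 𝟎
  ν-p = root f (trans (cong ν (sym q≡p^f)) ν-q)
    where
    root : ∀ n → ν (p ^ n) ≡ 𝟎 → ν p ≡ 𝟎
    root zero    eq = contradiction (trans (sym (⊕-identityʳ 𝟏)) eq) (𝟎≢𝟏 ∘ sym)
    root (suc n) eq with ν p ≟F 𝟎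
    ... | yes νp≡0 = νp≡0
    ... | no νp≢0  = root n (⊗-cancelˡ (ν p) νp≢0 (trans (sym (×1-homo-* p (p ^ n))) (trans eq (sym (⊗-zeroʳ (ν p))))))

  ν-multiple : ∀ {n m} → ν n ≡ 𝟎 → ν (m * n) ≡ 𝟎
  ν-multiple {n} {m} νn≡0 = trans (×1-homo-* m n) (trans (cong (ν m ⊗_) νn≡0) (⊗-zeroʳ (ν m)))

  ∣⇒ν≡𝟎 : ∀ {n} → p ∣ n → ν n ≡ 𝟎
  ∣⇒ν≡𝟎 (divides m refl) = ν-multiple {p} {m} ν-p

  -- If p did not divide n, Bézout would give multiples of p and n differing by 1, both with image
  -- 0.
  ν≡𝟎⇒∣ : ∀ {n} → ν n ≡ 𝟎 → p ∣ n
  ν≡𝟎⇒∣ {n} νn≡0 with p ∣? n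
  ... | yes p∣n = p∣n
  ... | no  p∤n = contradiction (coprime-Bézout coprime) λ
    { (Bézout.+- x y eq) → one (ν-multiple {n} {y} νn≡0) (ν-multiple {p} {x} ν-p) eq
    ; (Bézout.-+ x y eq) → one (ν-multiple {p} {x} ν-p) (ν-multiple {n} {y} νn≡0) eq }
    where
    coprime : Coprime p n
    coprime (d∣p , d∣n) with prime⇒irreducible p-prime d∣p
    ... | inj₁ d≡1 = d≡1
    ... | inj₂ refl = contradiction d∣n p∤n
    one : ∀ {a b} → ν a ≡ 𝟎 → ν b ≡ 𝟎 → 1 + a ≢ b
    one {a} νa νb refl = 𝟎≢𝟏 (trans (sym νb) (trans (cong (𝟏 ⊕_) νa) (⊕-identityʳ 𝟏)))

  remaining-term : ∀ {D n} (g : Fin (suc n) → ℕ) i → D ∣ sum g → (∀ j → j ≢ i → D ∣ g j) → D ∣ g i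
  remaining-term g i D∣sum D∣others = ∣m+n∣m⇒∣n
    (subst (_ ∣_) (trans (sum-remove g i) (+-comm (g i) _)) D∣sum)
    (sum-∣ λ j → D∣others (punchIn i j) (punchInᵢ≢i i j))

  -- Induction on `r` with `T` and `A` varying: the step passes to the columns killed by a vector
  -- `b′` and to the members of `A` vanishing there.
  divisibility-spreads : ∀ r {k} (T : List (V (suc k))) x (A : V (suc k) → Bool) → q ^ suc r ≤ card A →
    (∀ ψ → A ψ ≡ true → ⟨ ψ , x ⟩ ≡ 𝟏) →
    (∀ ψ → A ψ ≡ true → ∀ y → ⟨ ψ , y ⟩ ≡ 𝟎 → q ^ r * p ∣ w T y) →
    q ^ r * p ∣ w T x
  divisibility-spreads zero T x A q≤ Ax D∣w = subst (_∣ w T x) (sym (*-identityˡ p)) (ν≡𝟎⇒∣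
    (vanishes-on-hyperplanes x A (weight-poly T) ≤-refl (subst (_≤ card A) (*-identityʳ q) q≤) Ax
      (λ ψ Aψ y ψy≡0 → ∣⇒ν≡𝟎 (subst (_∣ w T y) (*-identityˡ p) (D∣w ψ Aψ y ψy≡0))) x))
  divisibility-spreads (suc r) {k} T x A q²≤ Ax D∣w
    with surjective-functional A (≤-trans (*-monoʳ-≤ q (m≤m*n q (q ^ r) {{m^n≢0 q r}})) q²≤)
  -- Pigeonhole over the q values at `b`: some value c is taken by at least a q-th of the required
  -- number of members.
  ... | b , onto with large-term (fibre A b) (subst (q ^ suc (suc r) ≤_) (sym (fibre-sum A b)) q²≤)
  ... | c , q≤fibre = remaining
    where
    D = q ^ suc r * p
    D≡ : D ≡ q * (q ^ r * p)
    D≡ = *-assoc q (q ^ r) p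
    -- Members of `A` are 1 at x, so this shifts all their values by -c: the large fibre now
    -- consists of members vanishing at `b′`, and all values are still attained.
    b′ = b ⊞ (⊖ c) · x
    T′ = killedBy b′ T
    A′ : V (suc k) → Bool
    A′ ψ = A ψ ∧ does (⟨ ψ , b ⟩ ≟F c)
    A′-sound : ∀ ψ → A′ ψ ≡ true → A ψ ≡ true × ⟨ ψ , b ⟩ ≡ c
    A′-sound ψ eq with A ψ | ⟨ ψ , b ⟩ ≟F c
    A′-sound ψ eq | true  | yes ψb≡c = refl , ψb≡c
    A′-sound ψ () | true  | no _
    A′-sound ψ () | false | _
    card-A′ : card A′ ≡ fibre A b c
    card-A′ = sumV-cong pointwise
      where
      pointwise : ∀ ψ → toℕᵇ (A′ ψ) ≡ toℕᵇ (A ψ) * χ (⟨ ψ , b ⟩ ≟F c)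
      pointwise ψ with A ψ
      ... | true  = sym (+-identityʳ _)
      ... | false = refl
    ψb′ : ∀ ψ → A ψ ≡ true → ⟨ ψ , b′ ⟩ ≡ ⟨ ψ , b ⟩ ⊕ ⊖ c
    ψb′ ψ Aψ = trans (⟨⟩-⊞·ʳ ψ b (⊖ c) x) (cong (⟨ ψ , b ⟩ ⊕_)
      (trans (cong ((⊖ c) ⊗_) (Ax ψ Aψ)) (⊗-identityʳ (⊖ c))))
    onto′ : ∀ v → ∃ λ ψ → A ψ ≡ true × ⟨ ψ , b′ ⟩ ≡ v
    onto′ v with onto (v ⊕ c)
    ... | ψ , Aψ , ψb≡ = ψ , Aψ , trans (ψb′ ψ Aψ) (trans (cong (_⊕ ⊖ c) ψb≡) (⊕-⊖-cancel v c))
    D∣wb′ : D ∣ w T b′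
    D∣wb′ with onto′ 𝟎
    ... | ψ , Aψ , ψb′≡0 = D∣w ψ Aψ b′ ψb′≡0
    D∣w′ : ∀ ψ → A′ ψ ≡ true → ∀ y → ⟨ ψ , y ⟩ ≡ 𝟎 → q ^ r * p ∣ w T′ y
    D∣w′ ψ A′ψ y ψy≡0 with A′-sound ψ A′ψ
    -- The line y + t `b′` stays in ker ψ, so its total weight is divisible by `D`, and so is the
    -- weight at `b′`. What remains of `line-sum` is q times the weight on `T′`, and one q cancels.
    ... | Aψ , ψb≡c = *-cancelˡ-∣ q (subst (_∣ q * w T′ y) D≡ (∣m+n∣m⇒∣n
      (subst (D ∣_) (trans (line-sum T y b′) (+-comm _ (q′ * w T b′))) (sum-∣ λ t → D∣w ψ Aψ (y ⊞ t · b′) (in-kernel t)))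
      (∣n⇒∣m*n q′ D∣wb′)))
      where
      in-kernel : ∀ t → ⟨ ψ , y ⊞ t · b′ ⟩ ≡ 𝟎
      in-kernel t = trans (⟨⟩-⊞·ʳ ψ y t b′) (trans (cong₂ _⊕_ ψy≡0 (trans (cong (t ⊗_)
        (trans (ψb′ ψ Aψ) (trans (cong (_⊕ ⊖ c) ψb≡c) (⊖-inverseʳ c)))) (⊗-zeroʳ t))) (⊕-identityˡ 𝟎))
    D∣total : D ∣ q * w T′ x + q′ * w T b′
    D∣total = ∣m∣n⇒∣m+n
      (subst (_∣ q * w T′ x) (sym D≡) (*-monoʳ-∣ q (divisibility-spreads r T′ x A′
        (subst (q ^ suc r ≤_) (sym card-A′) q≤fibre) (λ ψ A′ψ → Ax ψ (proj₁ (A′-sound ψ A′ψ))) D∣w′)))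
      (∣n⇒∣m*n q′ D∣wb′)
    remaining : D ∣ w T x
    remaining = subst (λ z → D ∣ w T z) (⊞-𝟎· x b′) (remaining-term (λ t → w T (x ⊞ t · b′)) 𝟎
      (subst (D ∣_) (sym (line-sum T x b′)) D∣total) others)
      where
      -- For t ≠ 0 a member with value -1/t at `b′` vanishes at x + t `b′`. Only the term t = 0 is
      -- left, and the divisible total settles it.
      others : ∀ t → t ≢ 𝟎 → D ∣ w T (x ⊞ t · b′)
      others t t≢0 with inverse t t≢0
      ... | t⁻¹ , tt⁻¹≡1 with onto′ (⊖ t⁻¹)
      ... | ψ , Aψ , ψb′≡ = D∣w ψ Aψ (x ⊞ t · b′) (trans (⟨⟩-⊞·ʳ ψ x t b′) (trans
        (cong₂ _⊕_ (Ax ψ Aψ) (trans (cong (t ⊗_) ψb′≡) (trans (sym (-‿distribʳ-* t t⁻¹)) (cong ⊖_ tt⁻¹≡1))))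
        (⊖-inverseʳ 𝟏)))

-- Residual codes, the Griesmer bound and divisibility of Griesmer codes.

module GriesmerCodes (q′ : ℕ) (𝔽 : DiscreteField (suc q′))
  (p f : ℕ) (p-prime : Prime p) (q≡p^f : suc q′ ≡ p ^ f) where

  open DiscreteField 𝔽
  open LinearAlgebra q′ 𝔽
  open SecondMoment q′ 𝔽
  open Spreading q′ 𝔽 p f p-prime q≡p^f

  -- `ι` parametrises a complement of the line spanned by `x`; `π` is its transpose, the restriction
  -- of functionals to that complement.
  record Complement {k} (x : V (suc k)) : Set where
    field
      ι           : V k → V (suc k)
      π           : V (suc k) → V k
      adjoint     : ∀ φ m → ⟨ φ , ι m ⟩ ≡ ⟨ π φ , m ⟩
      independent : ∀ m t → ι m ⊞ t · x ≡ 𝟘 → m ≡ 𝟘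
      spanning    : ∀ y → ∃ λ m → ∃ λ t → y ≡ ι m ⊞ t · x

  -- The coordinate hyperplane at the first nonzero entry of `x` serves.
  complement : ∀ {k} (x : V (suc k)) → x ≢ 𝟘 → Complement x
  complement (a ∷ x) x≢0 with a ≟F 𝟎
  complement {zero}  (a ∷ []) x≢0 | yes refl = contradiction refl x≢0
  complement {suc k} (a ∷ x)  x≢0 | yes refl = record
    { ι           = λ { (b ∷ m) → b ∷ ι m }
    ; π           = λ { (b ∷ φ) → b ∷ π φ }
    ; adjoint     = λ { (b ∷ φ) (c ∷ m) → cong (b ⊗ c ⊕_) (adjoint φ m) }
    ; independent = λ { (b ∷ m) t eq → cong₂ _∷_
        (trans (sym (trans (cong (b ⊕_) (⊗-zeroʳ t)) (⊕-identityʳ b))) (Vecₚ.∷-injectiveˡ eq))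
        (independent m t (Vecₚ.∷-injectiveʳ eq)) }
    ; spanning    = λ { (b ∷ y) → span b (spanning y) }
    }
    where
    x≢0′ : x ≢ 𝟘
    x≢0′ refl = x≢0 refl
    open Complement (complement x x≢0′)
    span : ∀ b {y} → (∃ λ m → ∃ λ t → y ≡ ι m ⊞ t · x) → _
    span b (m , t , eq) = b ∷ m , t , cong₂ _∷_ (sym (trans (cong (b ⊕_) (⊗-zeroʳ t)) (⊕-identityʳ b))) eq
  complement {k} (a ∷ x) x≢0 | no a≢0 = record
    { ι           = 𝟎 ∷_
    ; π           = tail
    ; adjoint     = λ { (b ∷ φ) m → trans (cong (_⊕ ⟨ φ , m ⟩) (⊗-zeroʳ b)) (⊕-identityˡ ⟨ φ , m ⟩) }
    ; independent = λ m t eq → indep m t (Vecₚ.∷-injectiveˡ eq) (Vecₚ.∷-injectiveʳ eq)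
    ; spanning    = λ { (b ∷ y) → span b y (inverse a a≢0) }
    }
    where
    indep : ∀ m t → 𝟎 ⊕ t ⊗ a ≡ 𝟎 → m ⊞ t · x ≡ 𝟘 → m ≡ 𝟘
    indep m t ta≡0 eq with t ≟F 𝟎
    ... | yes refl = trans (sym (⊞-𝟎· m x)) eq
    ... | no t≢0   = contradiction (trans (sym (⊕-identityˡ _)) ta≡0) (⊗-nonzero t≢0 a≢0)
    ⊞-cancel : ∀ {k} (y x : V k) t → y ≡ (y ⊞ (⊖ t) · x) ⊞ t · x
    ⊞-cancel []      []      t = refl
    ⊞-cancel (b ∷ y) (c ∷ x) t = cong₂ _∷_ (sym (trans (cong (λ z → (b ⊕ z) ⊕ t ⊗ c) (sym (-‿distribˡ-* t c)))
      (⊖-⊕-cancel b (t ⊗ c)))) (⊞-cancel y x t)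
    span : ∀ b y → (∃ λ a⁻¹ → a ⊗ a⁻¹ ≡ 𝟏) → ∃ λ m → ∃ λ t → b ∷ y ≡ (𝟎 ∷ m) ⊞ t · (a ∷ x)
    span b y (a⁻¹ , aa⁻¹≡1) = y ⊞ (⊖ t) · x , t , cong₂ _∷_ (sym head≡) (⊞-cancel y x t)
      where
      t = b ⊗ a⁻¹
      head≡ : 𝟎 ⊕ t ⊗ a ≡ b
      head≡ = trans (⊕-identityˡ _) (trans (⊗-assoc b a⁻¹ a)
        (trans (cong (b ⊗_) (trans (⊗-comm a⁻¹ a) aa⁻¹≡1)) (⊗-identityʳ b)))

  -- A lower bound on the nonzero weights, the form that subcodes inherit.
  MinWeight : ∀ {k} → ℕ → List (V k) → Set
  MinWeight d L = ∀ m → m ≢ 𝟘 → d ≤ w L m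

  w-map : ∀ {k l} (π : V k → V l) y m (L : List (V k)) → (∀ φ → ⟨ φ , y ⟩ ≡ ⟨ π φ , m ⟩) → w (map π L) m ≡ w L y
  w-map π y m []      adj = refl
  w-map π y m (φ ∷ L) adj = cong₂ _+_ (cong nz (sym (adj φ))) (w-map π y m L adj)

  length-killedBy : ∀ {k} c (L : List (V k)) → length L ≡ w L c + length (killedBy c L)
  length-killedBy c []      = refl
  length-killedBy c (φ ∷ L) with ⟨ φ , c ⟩ ≟F 𝟎
  ... | yes _ = trans (cong suc (length-killedBy c L)) (sym (+-suc (w L c) _))
  ... | no  _ = cong suc (length-killedBy c L)

  minimal-word : ∀ {k} (g : V (suc k) → ℕ) → ∃ λ c → c ≢ 𝟘 × (∀ m → m ≢ 𝟘 → g c ≤ g m)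
  minimal-word g = descend (g (𝟏 ∷ 𝟘)) (𝟏 ∷ 𝟘) (λ eq → 𝟎≢𝟏 (sym (Vecₚ.∷-injectiveˡ eq))) ≤-refl
    where
    descend : ∀ n c → c ≢ 𝟘 → g c ≤ n → ∃ λ c → c ≢ 𝟘 × (∀ m → m ≢ 𝟘 → g c ≤ g m)
    descend n c c≢0 gc≤n with ∃V? (λ m → ¬? (m ≟V 𝟘) ×-dec (g m <? g c))
    ... | no ¬p = c , c≢0 , λ m m≢0 → ≮⇒≥ λ gm<gc → ¬p (m , m≢0 , gm<gc)
    descend zero    c c≢0 gc≤0 | yes (m , m≢0 , gm<gc) = contradiction (<-≤-trans gm<gc gc≤0) λ ()
    descend (suc n) c c≢0 gc≤n | yes (m , m≢0 , gm<gc) = descend n m m≢0 (≤-pred (<-≤-trans gm<gc gc≤n))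

  -- The columns killed by a word c of minimum weight form the residual code on a complement of c.
  -- All words of the line ι m + t c weigh at least wt(c), so `line-sum` gives wt(c) ≤ q times the
  -- residual weight of m.
  griesmer-bound : ∀ k {d} (L : List (V k)) → MinWeight d L → griesmer q k d ≤ length L
  griesmer-bound zero        L wt≥d = z≤n
  griesmer-bound (suc k) {d} L wt≥d with minimal-word (w L)
  ... | c , c≢0 , c-min = begin
    griesmer q (suc k) d              ≤⟨ griesmer-mono q (suc k) (wt≥d c c≢0) ⟩
    griesmer q (suc k) (w L c)        ≡⟨ griesmer-suc q k (w L c) ⟩
    w L c + griesmer q k (ceilDiv (w L c) q)
      ≤⟨ +-monoʳ-≤ (w L c) (griesmer-bound k residual residual-weight) ⟩
    w L c + length residual           ≡⟨ cong (w L c +_) (length-map π (killedBy c L)) ⟩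
    w L c + length (killedBy c L)     ≡⟨ length-killedBy c L ⟨
    length L                          ∎
    where
    open ≤-Reasoning
    open Complement (complement c c≢0)
    residual : List (V k)
    residual = map π (killedBy c L)
    residual-weight : MinWeight (ceilDiv (w L c) q) residual
    residual-weight m m≢0 = ceilDiv-least {m = q} (+-cancelʳ-≤ (q′ * w L c) (w L c) _ (begin
      q * w L c                                      ≡⟨ sum-const q (w L c) ⟨
      sum {q} (λ t → w L c)
        ≤⟨ sum-mono (λ t → c-min (ι m ⊞ t · c) (m≢0 ∘ independent m t)) ⟩
      sum (λ t → w L (ι m ⊞ t · c))                  ≡⟨ line-sum L (ι m) c ⟩
      q * w (killedBy c L) (ι m) + q′ * w L c
        ≡⟨ cong (λ z → q * z + q′ * w L c) (w-map π (ι m) m (killedBy c L) (λ φ → adjoint φ m)) ⟨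
      q * w residual m + q′ * w L c                  ∎))

  module _ {k} (x : V (suc k)) where

    -- Where ψ(x) = 1, a column proportional to ψ must be φ(x) ψ, so this counts the columns on the
    -- point ψ without searching for a scalar.
    multiplicity : List (V (suc k)) → V (suc k) → ℕ
    multiplicity []      ψ = 0
    multiplicity (φ ∷ L) ψ = χ (φ ≟V ⟨ φ , x ⟩ · ψ) + multiplicity L ψ

    others : V (suc k) → List (V (suc k)) → List (V (suc k))
    others ψ = filter (λ φ → ¬? (φ ≟V ⟨ φ , x ⟩ · ψ))

    length-others : ∀ ψ L → length L ≡ multiplicity L ψ + length (others ψ L)
    length-others ψ []      = refl
    length-others ψ (φ ∷ L) with φ ≟V ⟨ φ , x ⟩ · ψ
    ... | yes _ = cong suc (length-others ψ L)
    ... | no  _ = trans (cong suc (length-others ψ L)) (sym (+-suc (multiplicity L ψ) _))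

    -- The discarded columns are multiples of ψ and contribute nothing on ker ψ.
    w-others : ∀ ψ L {y} → ⟨ ψ , y ⟩ ≡ 𝟎 → w (others ψ L) y ≡ w L y
    w-others ψ []      ψy≡0 = refl
    w-others ψ (φ ∷ L) {y} ψy≡0 with φ ≟V ⟨ φ , x ⟩ · ψ
    ... | no  _  = cong (nz ⟨ φ , y ⟩ +_) (w-others ψ L ψy≡0)
    ... | yes eq = trans (w-others ψ L ψy≡0) (cong (_+ w L y) (sym (nz-zero φy≡0)))
      where
      φy≡0 : ⟨ φ , y ⟩ ≡ 𝟎
      φy≡0 = trans (cong (λ z → ⟨ z , y ⟩) eq) (trans (⟨⟩-comm _ y) (trans (⟨⟩-·ʳ y ⟨ φ , x ⟩ ψ)
        (trans (cong (⟨ φ , x ⟩ ⊗_) (trans (⟨⟩-comm y ψ) ψy≡0)) (⊗-zeroʳ _))))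

    -- A column φ with φ(x) ≠ 0 is counted at its normalised multiple φ / φ(x).
    w≤multiplicities : ∀ L → w L x ≤ sumV (λ ψ → χ (⟨ ψ , x ⟩ ≟F 𝟏) * multiplicity L ψ)
    w≤multiplicities []      = z≤n
    w≤multiplicities (φ ∷ L) = begin
      nz ⟨ φ , x ⟩ + w L x          ≤⟨ +-mono-≤ (one (⟨ φ , x ⟩ ≟F 𝟎)) (w≤multiplicities L) ⟩
      sumV g + sumV h               ≡⟨ sumV-+ g h ⟨
      sumV (λ ψ → g ψ + h ψ)        ≡⟨ sumV-cong (λ ψ → *-distribˡ-+ (χ (⟨ ψ , x ⟩ ≟F 𝟏)) _ _) ⟨
      sumV (λ ψ → χ (⟨ ψ , x ⟩ ≟F 𝟏) * multiplicity (φ ∷ L) ψ) ∎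
      where
      open ≤-Reasoning
      g h : V (suc k) → ℕ
      g ψ = χ (⟨ ψ , x ⟩ ≟F 𝟏) * χ (φ ≟V ⟨ φ , x ⟩ · ψ)
      h ψ = χ (⟨ ψ , x ⟩ ≟F 𝟏) * multiplicity L ψ
      one : Dec (⟨ φ , x ⟩ ≡ 𝟎) → nz ⟨ φ , x ⟩ ≤ sumV g
      one (yes φx≡0) = subst (_≤ sumV g) (sym (nz-zero φx≡0)) z≤n
      one (no φx≢0) with inverse ⟨ φ , x ⟩ φx≢0
      ... | s , φx*s≡1 = ≤-trans (≤-reflexive (trans (nz-nonzero φx≢0) (sym (cong₂ _*_
          (χ-yes (⟨ s · φ , x ⟩ ≟F 𝟏) (trans (⟨⟩-comm (s · φ) x) (trans (⟨⟩-·ʳ x s φ) (trans (cong (s ⊗_) (⟨⟩-comm x φ)) (trans (⊗-comm s _) φx*s≡1)))))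
          (χ-yes (φ ≟V ⟨ φ , x ⟩ · s · φ) (sym (·-cancel φ)))))))
        (term≤sumV g (s · φ))
        where
        ·-cancel : ∀ {l} (v : V l) → ⟨ φ , x ⟩ · s · v ≡ v
        ·-cancel []      = refl
        ·-cancel (b ∷ v) = cong₂ _∷_ (trans (sym (⊗-assoc _ s b)) (trans (cong (_⊗ b) φx*s≡1) (⊗-identityˡ b))) (·-cancel v)

    module Subcode (C : Complement x) (ψ : V (suc k)) (ψx≡1 : ⟨ ψ , x ⟩ ≡ 𝟏) where

      open Complement C

      -- Correcting `ι m` along `x` identifies the messages of length k with ker ψ; `restrict` is
      -- the transpose of this map.
      embed : V k → V (suc k)
      embed m = ι m ⊞ (⊖ ⟨ ψ , ι m ⟩) · x

      restrict : V (suc k) → V k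
      restrict φ = π (φ ⊞ (⊖ ⟨ φ , x ⟩) · ψ)

      restrict-adjoint : ∀ φ m → ⟨ φ , embed m ⟩ ≡ ⟨ restrict φ , m ⟩
      restrict-adjoint φ m = begin
        ⟨ φ , embed m ⟩                                            ≡⟨ ⟨⟩-⊞·ʳ φ (ι m) (⊖ ⟨ ψ , ι m ⟩) x ⟩
        ⟨ φ , ι m ⟩ ⊕ (⊖ ⟨ ψ , ι m ⟩) ⊗ ⟨ φ , x ⟩
          ≡⟨ cong (⟨ φ , ι m ⟩ ⊕_) (trans (sym (-‿distribˡ-* _ _)) (trans (cong ⊖_ (⊗-comm _ _)) (-‿distribˡ-* _ _))) ⟩
        ⟨ φ , ι m ⟩ ⊕ (⊖ ⟨ φ , x ⟩) ⊗ ⟨ ψ , ι m ⟩                  ≡⟨ ⟨⟩-⊞·ˡ φ (⊖ ⟨ φ , x ⟩) ψ (ι m) ⟨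
        ⟨ φ ⊞ (⊖ ⟨ φ , x ⟩) · ψ , ι m ⟩                            ≡⟨ adjoint _ m ⟩
        ⟨ restrict φ , m ⟩                                         ∎
        where open ≡-Reasoning

      ψ-embed : ∀ m → ⟨ ψ , embed m ⟩ ≡ 𝟎
      ψ-embed m = trans (⟨⟩-⊞·ʳ ψ (ι m) (⊖ ⟨ ψ , ι m ⟩) x) (trans (cong (⟨ ψ , ι m ⟩ ⊕_)
        (trans (cong ((⊖ ⟨ ψ , ι m ⟩) ⊗_) ψx≡1) (⊗-identityʳ _))) (⊖-inverseʳ _))

      embed-onto : ∀ y → ⟨ ψ , y ⟩ ≡ 𝟎 → ∃ λ m → y ≡ embed m
      embed-onto y ψy≡0 with spanning y
      ... | m , t , refl = m , cong (λ s → ι m ⊞ s · x) (inverseʳ-unique ⟨ ψ , ι m ⟩ t (trans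
        (sym (trans (⟨⟩-⊞·ʳ ψ (ι m) t x) (cong (⟨ ψ , ι m ⟩ ⊕_) (trans (cong (t ⊗_) ψx≡1) (⊗-identityʳ t))))) ψy≡0))

      subcode : List (V (suc k)) → List (V k)
      subcode L = map restrict (others ψ L)

      w-subcode : ∀ L m → w (subcode L) m ≡ w L (embed m)
      w-subcode L m = trans (w-map restrict (embed m) m (others ψ L) (λ φ → restrict-adjoint φ m))
        (w-others ψ L (ψ-embed m))

      length-subcode : ∀ L → length L ≡ multiplicity L ψ + length (subcode L)
      length-subcode L = trans (length-others ψ L) (cong (multiplicity L ψ +_) (sym (length-map restrict (others ψ L))))

      subcode-weight : ∀ {d} L → MinWeight d L → MinWeight d (subcode L)
      subcode-weight {d} L wt≥d m m≢0 = subst (d ≤_) (sym (w-subcode L m))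
        (wt≥d (embed m) (m≢0 ∘ independent m (⊖ ⟨ ψ , ι m ⟩)))

  ∧-sound : ∀ {P Q : Set} (P? : Dec P) (Q? : Dec Q) → does P? ∧ does Q? ≡ true → P × Q
  ∧-sound (yes p) (yes q) _ = p , q
  ∧-sound (yes _) (no _) ()
  ∧-sound (no _)  _      ()

  -- By `griesmer-bound` the length condition says that the code meets the bound; an inequality is
  -- what the subcode on ker ψ delivers.
  griesmer-divisible : ∀ k (L : List (V k)) d i → 1 ≤ d → MinWeight d L → length L ≤ griesmer q k d →
                       q ^ suc i ∣ d → ∀ x → q ^ i * p ∣ w L x
  griesmer-divisible zero    L d i 1≤d wt≥d len≤ q∣d [] = subst (q ^ i * p ∣_) (sym (w-𝟘 L)) (_ ∣0)
  griesmer-divisible (suc k) L d i 1≤d wt≥d len≤ q∣d x with x ≟V 𝟘 | ceilDiv-lower (q ^ k) {{m^n≢0 q k}} 1≤d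
  ... | yes refl | _ = subst (q ^ i * p ∣_) (sym (w-𝟘 L)) (_ ∣0)
  ... | no x≢0 | a , ⌈⌉≡1+a , a*q^k<d = by-cases (≤-<-connex k i)
    where
    -- The columns off ψ form a code of dimension k with the same weight bound, so only the last
    -- Griesmer summand ⌈d/q^k⌉ = `suc a` is left for ψ.
    mult≤ : ∀ ψ → ⟨ ψ , x ⟩ ≡ 𝟏 → multiplicity x L ψ ≤ suc a
    mult≤ ψ ψx≡1 = +-cancelʳ-≤ (griesmer q k d) _ _ (begin
      multiplicity x L ψ + griesmer q k d
        ≤⟨ +-monoʳ-≤ (multiplicity x L ψ) (griesmer-bound k (subcode L) (subcode-weight L wt≥d)) ⟩
      multiplicity x L ψ + length (subcode L)      ≡⟨ length-subcode L ⟨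
      length L                                     ≤⟨ len≤ ⟩
      griesmer q k d + ceilDiv d (q ^ k)           ≡⟨ cong (griesmer q k d +_) ⌈⌉≡1+a ⟩
      griesmer q k d + suc a                       ≡⟨ +-comm (griesmer q k d) (suc a) ⟩
      suc a + griesmer q k d                       ∎)
      where
      open ≤-Reasoning
      open Subcode x (complement x x≢0) ψ ψx≡1

    S : V (suc k) → Bool
    S ψ = does (⟨ ψ , x ⟩ ≟F 𝟏) ∧ does (suc a ≤? multiplicity x L ψ)

    S-sound : ∀ ψ → S ψ ≡ true → ⟨ ψ , x ⟩ ≡ 𝟏 × suc a ≤ multiplicity x L ψ
    S-sound ψ = ∧-sound (⟨ ψ , x ⟩ ≟F 𝟏) (suc a ≤? multiplicity x L ψ)

    S-divisible : ∀ ψ → S ψ ≡ true → ∀ y → ⟨ ψ , y ⟩ ≡ 𝟎 → q ^ i * p ∣ w L y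
    S-divisible ψ Sψ y ψy≡0 with S-sound ψ Sψ
    ... | ψx≡1 , a<mult with Subcode.embed-onto x (complement x x≢0) ψ ψx≡1 y ψy≡0
    ... | m , refl = subst (q ^ i * p ∣_) (w-subcode L m)
      (griesmer-divisible k (subcode L) d i 1≤d (subcode-weight L wt≥d) len′≤ q∣d m)
      where
      open Subcode x (complement x x≢0) ψ ψx≡1
      len′≤ : length (subcode L) ≤ griesmer q k d
      len′≤ = +-cancelˡ-≤ (suc a) _ _ (begin
        suc a + length (subcode L)                ≤⟨ +-monoˡ-≤ _ a<mult ⟩
        multiplicity x L ψ + length (subcode L)   ≡⟨ length-subcode L ⟨
        length L                                  ≤⟨ len≤ ⟩
        griesmer q k d + ceilDiv d (q ^ k)        ≡⟨ cong (griesmer q k d +_) ⌈⌉≡1+a ⟩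
        griesmer q k d + suc a                    ≡⟨ +-comm (griesmer q k d) (suc a) ⟩
        suc a + griesmer q k d                    ∎)
        where open ≤-Reasoning

    -- Each of the q^k normalised points carries at most `a` columns, and one more exactly when it
    -- lies in `S`.
    w≤ : w L x ≤ a * q ^ k + card S
    w≤ = begin
      w L x                                                      ≤⟨ w≤multiplicities x L ⟩
      sumV (λ ψ → χ (⟨ ψ , x ⟩ ≟F 𝟏) * multiplicity x L ψ)       ≤⟨ sumV-mono pointwise ⟩
      sumV (λ ψ → a * χ (⟨ ψ , x ⟩ ≟F 𝟏) + toℕᵇ (S ψ))           ≡⟨ sumV-+ _ _ ⟩
      sumV (λ ψ → a * χ (⟨ ψ , x ⟩ ≟F 𝟏)) + card S
        ≡⟨ cong (_+ card S) (trans (sumV-*ˡ a _) (cong (a *_) (hyperplane-count x x≢0 𝟏))) ⟩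
      a * q ^ k + card S                                         ∎
      where
      open ≤-Reasoning
      bound : ∀ {P : Set} {n} (P? : Dec P) (a<n? : Dec (suc a ≤ n)) → (P → n ≤ suc a) →
              χ P? * n ≤ a * χ P? + toℕᵇ (does P? ∧ does a<n?)
      bound (no _)  _ _ = z≤n
      bound {n = n} (yes p) (yes _) n≤ = begin
        n + 0       ≡⟨ +-identityʳ n ⟩
        n           ≤⟨ n≤ p ⟩
        suc a       ≡⟨ +-comm 1 a ⟩
        a + 1       ≡⟨ cong (_+ 1) (*-identityʳ a) ⟨
        a * 1 + 1   ∎
      bound {n = n} (yes p) (no a≮n) _ = begin
        n + 0       ≡⟨ +-identityʳ n ⟩
        n           ≤⟨ ≤-pred (≰⇒> a≮n) ⟩
        a           ≡⟨ trans (+-identityʳ _) (*-identityʳ a) ⟨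
        a * 1 + 0   ∎
      pointwise : ∀ ψ → χ (⟨ ψ , x ⟩ ≟F 𝟏) * multiplicity x L ψ ≤ a * χ (⟨ ψ , x ⟩ ≟F 𝟏) + toℕᵇ (S ψ)
      pointwise ψ = bound (⟨ ψ , x ⟩ ≟F 𝟏) (suc a ≤? multiplicity x L ψ) (mult≤ ψ)

    card-S≤ : card S ≤ q ^ k
    card-S≤ = ≤-trans (sumV-mono pointwise) (≤-reflexive (hyperplane-count x x≢0 𝟏))
      where
      pointwise : ∀ ψ → toℕᵇ (S ψ) ≤ χ (⟨ ψ , x ⟩ ≟F 𝟏)
      pointwise ψ with ⟨ ψ , x ⟩ ≟F 𝟏 | does (suc a ≤? multiplicity x L ψ)
      ... | no _  | _     = z≤n
      ... | yes _ | true  = ≤-refl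
      ... | yes _ | false = z≤n

    by-cases : k ≤ i ⊎ i < k → q ^ i * p ∣ w L x
    -- Here q^k divides d, so the count above gives weight at most d, hence exactly d. Then p ∣ q
    -- turns q^(i+1) ∣ d into the claim.
    by-cases (inj₁ k≤i) = subst (q ^ i * p ∣_) (≤-antisym (wt≥d x x≢0) w≤d)
      (∣-trans (subst (q ^ i * p ∣_) (*-comm (q ^ i) q) (*-monoʳ-∣ (q ^ i) (ν≡𝟎⇒∣ ν-q))) q∣d)
      where
      q^k∣d : q ^ k ∣ d
      q^k∣d = ∣-trans (^-monoʳ-∣ q (≤-trans k≤i (n≤1+n i))) q∣d
      open ≤-Reasoning
      w≤d : w L x ≤ d
      w≤d = begin
        w L x                       ≤⟨ w≤ ⟩
        a * q ^ k + card S          ≤⟨ +-monoʳ-≤ (a * q ^ k) card-S≤ ⟩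
        a * q ^ k + q ^ k           ≡⟨ +-comm (a * q ^ k) (q ^ k) ⟩
        suc a * q ^ k               ≡⟨ cong (_* q ^ k) ⌈⌉≡1+a ⟨
        ceilDiv d (q ^ k) * q ^ k
          ≤⟨ *-monoˡ-≤ (q ^ k) (ceilDiv-least {{m^n≢0 q k}} (≤-reflexive (trans (_∣_.equality q^k∣d) (*-comm (quotient q^k∣d) (q ^ k))))) ⟩
        quotient q^k∣d * q ^ k      ≡⟨ _∣_.equality q^k∣d ⟨
        d                           ∎
    by-cases (inj₂ i<k) = divisibility-spreads i L x S enough (λ ψ Sψ → proj₁ (S-sound ψ Sψ)) S-divisible
      where
      open ≤-Reasoning
      -- Since i < k, both a q^k and d are multiples of q^(i+1); the first is strictly smaller, so
      -- they differ by at least q^(i+1).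
      enough : q ^ suc i ≤ card S
      enough = +-cancelˡ-≤ (a * q ^ k) _ _ (begin
        a * q ^ k + q ^ suc i   ≤⟨ next-multiple (∣n⇒∣m*n a (^-monoʳ-∣ q i<k)) q∣d a*q^k<d ⟩
        d                       ≤⟨ wt≥d x x≢0 ⟩
        w L x                   ≤⟨ w≤ ⟩
        a * q ^ k + card S      ∎)

-- Moving the field structure to indices.

module Transport {q : ℕ} (F : FiniteField q) where

  open FiniteField F
    using (Carrier; _≈_; 0#; 1#; commRing; 0≉1; inverse; enum; enum-sur; enum-inj; *-cong)
    renaming ( _+_ to _⊞_; _*_ to _⊠_; -_ to ⊟_
             ; refl to ≈-refl; sym to ≈-sym; trans to ≈-trans; reflexive to ≈-reflexive )

  index : Carrier → Fin q
  index x = proj₁ (enum-sur x)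

  enum-index : ∀ x → enum (index x) ≈ x
  enum-index x = proj₂ (enum-sur x)

  index-enum : ∀ i → index (enum i) ≡ i
  index-enum i = enum-inj _ _ (enum-index (enum i))

  index-cong : ∀ {x y} → x ≈ y → index x ≡ index y
  index-cong x≈y = enum-inj _ _ (≈-trans (enum-index _) (≈-trans x≈y (≈-sym (enum-index _))))

  indexRing : RawRing 0ℓ 0ℓ
  indexRing = record
    { Carrier = Fin q
    ; _≈_     = _≡_
    ; _+_     = λ i j → index (enum i ⊞ enum j)
    ; _*_     = λ i j → index (enum i ⊠ enum j)
    ; -_      = λ i → index (⊟ enum i)
    ; 0#      = index 0#
    ; 1#      = index 1#
    }

  -- The operations on indices are defined through `enum`, so it preserves them; being injective, it
  -- pulls the ring laws back.
  enum-isRingMonomorphism : IsRingMonomorphism indexRing (CommutativeRing.rawRing commRing) enum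
  enum-isRingMonomorphism = record
    { isRingHomomorphism = record
      { isSemiringHomomorphism = record
        { isNearSemiringHomomorphism = record
          { +-isMonoidHomomorphism = record
            { isMagmaHomomorphism = record
              { isRelHomomorphism = record { cong = ≈-reflexive ∘ cong enum }
              ; homo = λ i j → enum-index _
              }
            ; ε-homo = enum-index 0#
            }
          ; *-homo = λ i j → enum-index _
          }
        ; 1#-homo = enum-index 1#
        }
      ; -‿homo = λ i → enum-index _
      }
    ; injective = enum-inj _ _
    }

  discreteField : DiscreteField q
  discreteField = record
    { isCommutativeRing = RingMonomorphism.isCommutativeRing enum-isRingMonomorphism
        (CommutativeRing.isCommutativeRing commRing)
    ; 𝟎≢𝟏     = λ eq → 0≉1 (≈-trans (≈-sym (enum-index 0#)) (≈-trans (≈-reflexive (cong enum eq)) (enum-index 1#)))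
    ; inverse = λ i i≢0 → let (y , iy≈1) = inverse (enum i) (λ i≈0 → i≢0 (trans (sym (index-enum i)) (index-cong i≈0)))
                          in index y , index-cong (≈-trans (*-cong ≈-refl (enum-index y)) iy≈1)
    }

-- From generator matrices to lists of functionals.

module _ {q′ : ℕ} (F : FiniteField (suc q′)) where

  open FiniteField F using (_≈_; 0#; enum; enum-inj; +-cong; *-cong)
    renaming ( _+_ to _⊞_; _*_ to _⊠_; *-comm to ⊠-comm; _≟_ to _≟ᶠ_
             ; sym to ≈-sym; trans to ≈-trans; reflexive to ≈-reflexive )
  open Transport F
  open LinearAlgebra q′ discreteField using (V; ⟨_,_⟩; w; 𝟘; nz-zero; nz-nonzero)

  vector : ∀ {k} → Word F k → V k
  vector m = tabulate (index ∘ m)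

  columns : ∀ {k n} → Matrix F k n → List (V k)
  columns G = List.tabulate λ j → vector λ i → G i j

  enum-⟨⟩ : ∀ {k} (u m : Word F k) → enum ⟨ vector u , vector m ⟩ ≈ Vector.foldr _⊞_ 0# (λ i → m i ⊠ u i)
  enum-⟨⟩ {zero}  u m = enum-index 0#
  enum-⟨⟩ {suc k} u m = ≈-trans (enum-index _) (+-cong
    (≈-trans (enum-index _) (≈-trans (*-cong (enum-index (u zero)) (enum-index (m zero))) (⊠-comm (u zero) (m zero))))
    (enum-⟨⟩ (u ∘ suc) (m ∘ suc)))

  wt≡w : ∀ {k n} (G : Matrix F k n) m → wt F (encode F G m) ≡ w (columns G) (vector m)
  wt≡w {n = zero}  G m = refl
  wt≡w {n = suc n} G m with encode F G m zero ≟ᶠ 0#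
  ... | yes c≈0 = cong₂ _+_ (sym (nz-zero (enum-inj _ _ (≈-trans (enum-⟨⟩ (λ i → G i zero) m) (≈-trans c≈0 (≈-sym (enum-index 0#)))))))
                    (wt≡w (λ i → G i ∘ suc) m)
  ... | no c≉0  = cong₂ _+_ (sym (nz-nonzero λ eq → c≉0 (≈-trans (≈-sym (enum-⟨⟩ (λ i → G i zero) m))
                    (≈-trans (≈-reflexive (cong enum eq)) (enum-index 0#)))))
                    (wt≡w (λ i → G i ∘ suc) m)

  vector-onto : ∀ {k} (v : V k) → vector (enum ∘ lookup v) ≡ v
  vector-onto v = trans (Vecₚ.tabulate-cong (λ i → index-enum (lookup v i))) (Vecₚ.tabulate∘lookup v)

  vector-zero : ∀ {k} (m : Word F k) → isZero F m → vector m ≡ 𝟘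
  vector-zero {zero}  m m≈0 = refl
  vector-zero {suc k} m m≈0 = cong₂ _∷_ (index-cong (m≈0 zero)) (vector-zero (m ∘ suc) (m≈0 ∘ suc))

  linearCode-weight : ∀ {k n d} {G : Matrix F k n} → IsLinearCode F G d → ∀ v → v ≢ 𝟘 → d ≤ w (columns G) v
  linearCode-weight {d = d} {G} code v v≢0 = subst (d ≤_)
    (trans (wt≡w G (enum ∘ lookup v)) (cong (w (columns G)) (vector-onto v)))
    (IsLinearCode.minWeight≥ code (enum ∘ lookup v)
      λ zero → v≢0 (trans (sym (vector-onto v)) (vector-zero (enum ∘ lookup v) zero)))

-- Comparison of exponents and the conclusion.

-- Both sides vanish for f = 1; for f ≥ 2 one has q ≥ 4, so q - 2 ≥ 2.
exponent-bound : ∀ {p} f′ {q} → Prime p → q ≡ p ^ suc f′ → f′ + f′ ≤ f′ * (q ∸ 2)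
exponent-bound zero    p-prime _ = z≤n
exponent-bound {p} (suc f) p-prime refl = begin
  suc f + suc f                 ≡⟨ cong (suc f +_) (+-identityʳ (suc f)) ⟨
  2 * suc f                     ≡⟨ *-comm 2 (suc f) ⟩
  suc f * 2                     ≤⟨ *-monoʳ-≤ (suc f) (∸-monoˡ-≤ 2 4≤q) ⟩
  suc f * (p ^ suc (suc f) ∸ 2) ∎
  where
  open ≤-Reasoning
  4≤q : 4 ≤ p ^ suc (suc f)
  4≤q = ≤-trans (^-monoʳ-≤ 2 {2} {suc (suc f)} (s≤s (s≤s z≤n)))
    (^-monoˡ-≤ (suc (suc f)) (nonTrivial⇒n>1 p {{prime⇒nonTrivial p-prime}}))

-- Write e = r + (i + 1) f with r < f.  All weights are divisible by q^i p = p^(f i + 1), and since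
-- r ≤ f - 1 the claimed exponent is at most f i + 1 as soon as 2 (f - 1) ≤ (f - 1) (q - 2).
weights-divisible : (p f : ℕ) → Prime p → 1 ≤ f → ∀ q → q ≡ p ^ f → (k d e : ℕ) → 1 ≤ d →
  (F : FiniteField q) (G : Matrix F k (griesmer q k d)) → IsLinearCode F G d → p ^ e ∣ d →
  (m : Word F k) → p ^ (e ∸ (f ∸ 1) * (q ∸ 2)) ∣ wt F (encode F G m)
weights-divisible p f p-prime 1≤f zero q≡p^f k d e 1≤d F = contradiction (FiniteField.enum-sur F (FiniteField.0# F)) λ ()
weights-divisible p (suc f′) p-prime 1≤f q@(suc q′) q≡p^f k d e 1≤d F G code p^e∣d m with ≤-<-connex (suc f′) e
-- For e < f the truncated exponent is 0, and the claim is divisibility by 1.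
... | inj₂ e<f = subst (λ n → p ^ n ∣ wt F (encode F G m))
  (sym (m≤n⇒m∸n≡0 (≤-trans (≤-trans (≤-pred e<f) (m≤m+n f′ f′)) (exponent-bound f′ p-prime q≡p^f)))) (1∣ _)
... | inj₁ f≤e with e / suc f′ in e/f | m≥n⇒m/n>0 {e} {suc f′} f≤e
... | suc i | _ = ∣-trans (^-monoʳ-∣ p exponent≤) (subst (_∣ wt F (encode F G m)) q^i*p
    (subst (q ^ i * p ∣_) (sym (wt≡w F G m))
      (griesmer-divisible k (columns F G) d i 1≤d (linearCode-weight F code)
        (≤-reflexive (length-tabulate (λ j → vector F λ i → G i j)))
        (∣-trans (subst (_∣ p ^ e) (sym q^1+i) (^-monoʳ-∣ p f*1+i≤e)) p^e∣d) (vector F m))))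
  where
  open GriesmerCodes q′ (Transport.discreteField F) p (suc f′) p-prime q≡p^f
  f = suc f′
  e≡ : e ≡ e % f + suc i * f
  e≡ = trans (m≡m%n+[m/n]*n e f) (cong (λ j → e % f + j * f) e/f)
  f*1+i≤e : f * suc i ≤ e
  f*1+i≤e = ≤-trans (≤-reflexive (*-comm f (suc i))) (≤-trans (m≤n+m _ (e % f)) (≤-reflexive (sym e≡)))
  q^1+i : q ^ suc i ≡ p ^ (f * suc i)
  q^1+i = trans (cong (_^ suc i) q≡p^f) (^-*-assoc p f (suc i))
  q^i*p : q ^ i * p ≡ p ^ suc (f * i)
  q^i*p = trans (*-comm (q ^ i) p) (cong (p *_) (trans (cong (_^ i) q≡p^f) (^-*-assoc p f i)))
  exponent≤ : e ∸ f′ * (q ∸ 2) ≤ suc (f * i)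
  exponent≤ = m≤n+o⇒m∸n≤o e (f′ * (q ∸ 2)) (begin
    e                              ≡⟨ e≡ ⟩
    e % f + (f + i * f)            ≤⟨ +-monoˡ-≤ _ (≤-pred (m%n<n e f)) ⟩
    f′ + (f + i * f)               ≡⟨ +-assoc f′ f (i * f) ⟨
    (f′ + suc f′) + i * f          ≡⟨ cong (_+ i * f) (+-suc f′ f′) ⟩
    suc (f′ + f′) + i * f          ≡⟨ +-suc (f′ + f′) (i * f) ⟨
    (f′ + f′) + suc (i * f)
      ≤⟨ +-mono-≤ (exponent-bound f′ p-prime q≡p^f) (≤-reflexive (cong suc (*-comm i f))) ⟩
    f′ * (q ∸ 2) + suc (f * i)     ∎)
    where
    open ≤-Reasoning

-- Truncated subtraction encodes the ceiling: a negative exponent becomes 0, and p^0 = 1 is the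
-- ceiling of a negative power of p.
theorem1p8 : (p f : ℕ) → Prime p → 1 ≤ f →
    (k d e : ℕ) → 1 ≤ k → 1 ≤ d →
    (F : FiniteField (p ^ f)) →
    (G : Matrix F k (griesmer (p ^ f) k d)) → IsLinearCode F G d →
    p ^ e ∣ d →
    (m : Word F k) →
    p ^ (e ∸ (f ∸ 1) * (p ^ f ∸ 2)) ∣ wt F (encode F G m)
theorem1p8 p f p-prime 1≤f k d e _ 1≤d F G code p^e∣d m =
  weights-divisible p f p-prime 1≤f (p ^ f) refl k d e 1≤d F G code p^e∣d m
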